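{- Let $n\ge 1$ and $m\ge 2$ be integers. Assume that there exists a symmetric $5$-class association scheme on $4n^2(m+1)$ vertices whose adjacency matrices $A_0,\dots,A_5$ and primitive idempotents $E_0,\dots,E_5$ can be ordered so that its first and second eigenmatrices (rows and columns indexed by $0,\dots,5$) are $$P=\begin{pmatrix} 1&2n-1&2n(2n-1)&2nm&n(2n-1)m&n(2n-1)m\\ 1&-1&0&0&nm&-nm\\ 1&2n-1&-2n&2nm&-nm&-nm\\ 1&2n-1&-2n&-2n&n&n\\ 1&-1&0&0&-n&n\\ 1&2n-1&2n(2n-1)&-2n&-n(2n-1)&-n(2n-1) \end{pmatrix}$$ and $$Q=\begin{pmatrix} 1&2n(2n-1)&2n-1&(2n-1)m&2n(2n-1)m&m\\ 1&-2n&2n-1&(2n-1)m&-2nm&m\\ 1&0&-1&-m&0&m\\ 1&0&2n-1&-2n+1&0&-1\\ 1&2n&-1&1&-2n&-1\\ 1&-2n&-1&1&2n&-1 \end{pmatrix}.$$ Then there exists a set $\{H_1,\dots,H_m\}$ of $m$ mutually unbiased Bush-type Hadamard matrices of order $4n^2$.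
   Context: $I_k$ and $J_k$ denote the identity matrix and the all-ones matrix of order $k$. A symmetric $d$-class association scheme on a vertex set of size $N$ is a set of nonzero symmetric $(0,1)$-matrices $A_0,\dots,A_d$ of order $N$ (the adjacency matrices) such that (1) $A_0=I_N$; (2) $\sum_{i=0}^d A_i=J_N$; (3) for all $i,j$, $A_iA_j=\sum_{k=0}^d p_{ij}^kA_k$ for some numbers $p_{ij}^k$. The span of the $A_i$ is a commutative algebra, with a basis of primitive idempotents $E_0=\frac1N J_N,E_1,\dots,E_d$. The first eigenmatrix $P=(P_{ij})$ and second eigenmatrix $Q=(Q_{ij})$ are defined by $A_j=\sum_{i=0}^d P_{ij}E_i$ and $E_j=\frac1N\sum_{i=0}^d Q_{ij}A_i$. A Hadamard matrix of order $k$ is a $k\times k$ matrix with entries in $\{ -1,1\}$ and pairwise orthogonal rows. Two Hadamard matrices $H,K$ of order $k$ are unbiased if $HK^t=\sqrt{k}\,L$ for some Hadamard matrix $L$; a set of Hadamard matrices is mutually unbiased if any two distinct members are unbiased. A Bush-type Hadamard matrix of order $4n^2$ is a Hadamard matrix $H=[H_{ij}]_{1\le i,j\le 2n}$ of order $4n^2$, partitioned into $2n\times 2n$ blocks $H_{ij}$, such that $H_{ii}=J_{2n}$ for all $i$ and $H_{ij}J_{2n}=J_{2n}H_{ij}=0$ for all $i\neq j$. -}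

module Defs where

open import Algebra.Bundles using (CommutativeRing)
open import Data.Bool.Base using (if_then_else_)
open import Data.Fin.Base using (Fin; zero; suc; combine)
open import Data.Fin.Properties using (_≟_; nonZeroIndex)
open import Data.Integer.Base using (+_)
open import Data.Nat.Base as ℕ using (ℕ; NonZero)
import Data.Nat.Literals as ℕLiterals
open import Data.Product.Base using (∃-syntax; _×_; proj₁)
open import Data.Rational.Base using (ℚ; 0ℚ; 1ℚ; _+_; _-_; _*_; -_; _≤_; _/_)
import Data.Rational.Literals as ℚLiterals
open import Data.Rational.Properties using (+-*-commutativeRing)
open import Data.Sum.Base using (_⊎_)
open import Data.Unit.Base using (⊤; tt)
open import Data.Vec.Base using (Vec; []; _∷_; lookup)
open import Relation.Binary.PropositionalEquality.Core using (_≡_; _≢_)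
open import Relation.Nullary.Decidable.Core using (does)
open import Relation.Nullary.Negation.Core using (¬_)

open import Algebra.Properties.Semiring.Sum (CommutativeRing.semiring +-*-commutativeRing) using (sum)

fromℕ : ℕ → ℚ
fromℕ n = ℚLiterals.fromℤ (+ n)

Matrix : ℕ → ℕ → Set
Matrix r c = Fin r → Fin c → ℚ

SqMatrix : ℕ → Set
SqMatrix k = Matrix k k

infix  4 _≋_
infixl 6 _⊞_
infixl 7 _⊡_ _⊛_
infix  8 _ᵗ

_≋_ : ∀ {r c} → Matrix r c → Matrix r c → Set
M ≋ M′ = ∀ x y → M x y ≡ M′ x y

I : ∀ k → SqMatrix k
I k x y = if does (x ≟ y) then 1ℚ else 0ℚ

J : ∀ k → SqMatrix k
J k x y = 1ℚ

O : ∀ {r c} → Matrix r c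
O x y = 0ℚ

_⊞_ : ∀ {r c} → Matrix r c → Matrix r c → Matrix r c
(M ⊞ M′) x y = M x y + M′ x y

_⊡_ : ∀ {r c} → ℚ → Matrix r c → Matrix r c
(q ⊡ M) x y = q * M x y

_⊛_ : ∀ {r k c} → Matrix r k → Matrix k c → Matrix r c
(M ⊛ M′) x y = sum (λ z → M x z * M′ z y)

_ᵗ : ∀ {r c} → Matrix r c → Matrix c r
(M ᵗ) x y = M y x

lincomb : ∀ {r c k} → (Fin k → ℚ) → (Fin k → Matrix r c) → Matrix r c
lincomb q M x y = sum (λ i → q i * M i x y)

InSpan : ∀ {r c k} → (Fin k → Matrix r c) → Matrix r c → Set
InSpan M X = ∃[ q ] X ≋ lincomb q M

record AssociationScheme (d N : ℕ) : Set where
  field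
    A         : Fin (ℕ.suc d) → SqMatrix N
    nonzero   : ∀ i → ∃[ x ] ∃[ y ] A i x y ≢ 0ℚ
    symmetric : ∀ i → A i ᵗ ≋ A i
    zeroOne   : ∀ i x y → A i x y ≡ 0ℚ ⊎ A i x y ≡ 1ℚ
    identity  : A zero ≋ I N
    partition : lincomb (λ _ → 1ℚ) A ≋ J N
    closed    : ∀ i j → InSpan A (A i ⊛ A j)

  order-nonZero : NonZero N
  order-nonZero = nonZeroIndex (proj₁ (nonzero zero))

  1/order : ℚ
  1/order = (+ 1 / N) {{order-nonZero}}

  InAlgebra : SqMatrix N → Set
  InAlgebra = InSpan A

  record IsIdempotent (F : SqMatrix N) : Set where
    field
      inAlgebra  : InAlgebra F
      idempotent : F ⊛ F ≋ F

  record IsPrimitiveIdempotent (F : SqMatrix N) : Set where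
    field
      isIdempotent   : IsIdempotent F
      nonzero        : ¬ (F ≋ O)
      indecomposable : ∀ F₁ F₂ → IsIdempotent F₁ → IsIdempotent F₂ →
                       F₁ ⊛ F₂ ≋ O → F₂ ⊛ F₁ ≋ O → F ≋ F₁ ⊞ F₂ →
                       F₁ ≋ O ⊎ F₂ ≋ O

  record IsPrimitiveIdempotentBasis (E : Fin (ℕ.suc d) → SqMatrix N) : Set where
    field
      first       : E zero ≋ 1/order ⊡ J N
      isPrimitive : ∀ i → IsPrimitiveIdempotent (E i)
      independent : ∀ q → lincomb q E ≋ O → ∀ i → q i ≡ 0ℚ
      spanning    : ∀ M → InAlgebra M → InSpan E M

  IsFirstEigenmatrix : (E : Fin (ℕ.suc d) → SqMatrix N) → SqMatrix (ℕ.suc d) → Set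
  IsFirstEigenmatrix E P = ∀ j → A j ≋ lincomb (λ i → P i j) E

  IsSecondEigenmatrix : (E : Fin (ℕ.suc d) → SqMatrix N) → SqMatrix (ℕ.suc d) → Set
  IsSecondEigenmatrix E Q = ∀ j → E j ≋ 1/order ⊡ lincomb (λ i → Q i j) A

record IsHadamard {k : ℕ} (H : SqMatrix k) : Set where
  field
    entries    : ∀ x y → H x y ≡ 1ℚ ⊎ H x y ≡ - 1ℚ
    orthogonal : ∀ x y → x ≢ y → sum (λ z → H x z * H y z) ≡ 0ℚ

-- The square root is taken in ℚ. This loses nothing: H Kᵗ and L have
-- rational entries and those of L are ±1, so H Kᵗ = √k L forces √k ∈ ℚ.
Unbiased : ∀ {k} → SqMatrix k → SqMatrix k → Set
Unbiased {k} H K =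
  ∃[ √k ] 0ℚ ≤ √k × √k * √k ≡ fromℕ k ×
    ∃[ L ] IsHadamard L × H ⊛ K ᵗ ≋ √k ⊡ L

MutuallyUnbiased : ∀ {m k} → (Fin m → SqMatrix k) → Set
MutuallyUnbiased H = ∀ i j → ¬ (H i ≋ H j) → Unbiased (H i) (H j)

Distinct : ∀ {m k} → (Fin m → SqMatrix k) → Set
Distinct H = ∀ i j → H i ≋ H j → i ≡ j

-- combine i x is the x-th index of the i-th consecutive group of b indices.
block : ∀ a b → SqMatrix (a ℕ.* b) → Fin a → Fin a → SqMatrix b
block a b H i j x y = H (combine i x) (combine j y)

record IsBushType (n : ℕ) (H : SqMatrix ((2 ℕ.* n) ℕ.* (2 ℕ.* n))) : Set where
  field
    isHadamard    : IsHadamard H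
    diagonal      : ∀ i → block (2 ℕ.* n) (2 ℕ.* n) H i i ≋ J (2 ℕ.* n)
    off-diagonalʳ : ∀ i j → i ≢ j → block (2 ℕ.* n) (2 ℕ.* n) H i j ⊛ J (2 ℕ.* n) ≋ O
    off-diagonalˡ : ∀ i j → i ≢ j → J (2 ℕ.* n) ⊛ block (2 ℕ.* n) (2 ℕ.* n) H i j ≋ O

module Eigenmatrices (n′ m′ : ℕ) where

  open import Agda.Builtin.FromNat using (Number; fromNat)

  private
    instance
      ℚ-number : Number ℚ
      ℚ-number = ℚLiterals.number

      ℕ-number : Number ℕ
      ℕ-number = ℕLiterals.number

    n m : ℚ
    n = fromℕ n′
    m = fromℕ m′

    rowsP : Vec (Vec ℚ 6) 6
    rowsP =
      (1 ∷ 2 * n - 1 ∷ 2 * n * (2 * n - 1) ∷ 2 * n * m ∷ n * (2 * n - 1) * m   ∷ n * (2 * n - 1) * m   ∷ []) ∷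
      (1 ∷ - 1       ∷ 0                   ∷ 0         ∷ n * m                 ∷ - (n * m)             ∷ []) ∷
      (1 ∷ 2 * n - 1 ∷ - (2 * n)           ∷ 2 * n * m ∷ - (n * m)             ∷ - (n * m)             ∷ []) ∷
      (1 ∷ 2 * n - 1 ∷ - (2 * n)           ∷ - (2 * n) ∷ n                     ∷ n                     ∷ []) ∷
      (1 ∷ - 1       ∷ 0                   ∷ 0         ∷ - n                   ∷ n                     ∷ []) ∷
      (1 ∷ 2 * n - 1 ∷ 2 * n * (2 * n - 1) ∷ - (2 * n) ∷ - (n * (2 * n - 1))   ∷ - (n * (2 * n - 1))   ∷ []) ∷ []

    rowsQ : Vec (Vec ℚ 6) 6
    rowsQ =
      (1 ∷ 2 * n * (2 * n - 1) ∷ 2 * n - 1 ∷ (2 * n - 1) * m ∷ 2 * n * (2 * n - 1) * m ∷ m   ∷ []) ∷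
      (1 ∷ - (2 * n)           ∷ 2 * n - 1 ∷ (2 * n - 1) * m ∷ - (2 * n * m)           ∷ m   ∷ []) ∷
      (1 ∷ 0                   ∷ - 1       ∷ - m             ∷ 0                       ∷ m   ∷ []) ∷
      (1 ∷ 0                   ∷ 2 * n - 1 ∷ - (2 * n) + 1   ∷ 0                       ∷ - 1 ∷ []) ∷
      (1 ∷ 2 * n               ∷ - 1       ∷ 1               ∷ - (2 * n)               ∷ - 1 ∷ []) ∷
      (1 ∷ - (2 * n)           ∷ - 1       ∷ 1               ∷ 2 * n                   ∷ - 1 ∷ []) ∷ []

  P : SqMatrix 6
  P i j = lookup (lookup rowsP i) j

  Q : SqMatrix 6
  Q i j = lookup (lookup rowsQ i) j

open Eigenmatrices public using (P; Q)

{-# OPTIONS --safe #-}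

-- Write B = A₀ + A₁ + A₂, D = A₀ + A₁ + A₃ and G = 2n A₀ + A₃ + A₄ − A₅. The
-- eigenvalues in P show that B and D are multiples of idempotents, hence
-- equivalence relations with m + 1 classes ("groups") of size 4n² and with 2n
-- classes ("layers"); BD = 2nJ says that a group and a layer meet in a "cell" of
-- 2n vertices. So every group is indexed by Fin 2n × Fin 2n, and G splits into
-- blocks G_gh of order 4n² with G_gg = 2nI and, for g ≠ h, entries ±1.
--
-- The key identity is G_gh G_hk = 2n G_gk for g ≠ h. Fix a row x in group g, let u
-- be that row of G restricted to group h, and put w = u − 2n eₓ. Since
-- G_hh = 2nI and all entries of u are ±1, wGwᵗ = 0; since G² is a
-- multiple of G, |wG|² is a multiple of wGwᵗ, so wG = 0, which is the identity.
--
-- Consequently H_i = G_{i0}, i = 1, …, m, are Hadamard, with H_i H_jᵗ = 2n G_ij, and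
-- G (A₀ + A₁) = 2nD gives the vanishing row and column sums of the Bush blocks.
module Submission where

open import Algebra.Bundles using (CommutativeRing)
open import Data.Bool.Base using (Bool; true; false; if_then_else_; _∧_)
open import Data.Fin.Base using (Fin; zero; suc; combine; remQuot; fromℕ<; _↑ˡ_; _↑ʳ_)
open import Data.Fin.Patterns using (0F; 1F; 2F; 3F; 4F; 5F)
open import Data.Fin.Properties using (_≟_; suc-injective; all?; ¬∀⟶∃¬; remQuot-combine; combine-remQuot)
import Data.Integer.Base as ℤ
import Data.Integer.Properties as ℤ
open import Data.Nat.Base as ℕ using (ℕ; zero; suc)
import Data.Nat.Properties as ℕ
open import Data.Product.Base using (Σ-syntax; ∃-syntax; _×_; _,_; proj₁; proj₂; uncurry)
open import Data.Rational.Base using (ℚ; 0ℚ; 1ℚ; _+_; _-_; _*_; -_; _≤_; 1/_; ≢-nonZero; nonNegative)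
open import Data.Rational.Properties renaming (_≟_ to _≟ℚ_)
open import Data.Rational.Solver using (module +-*-Solver)
import Data.Rational.Unnormalised.Base as ℚᵘ
import Data.Rational.Unnormalised.Properties as ℚᵘ
open import Data.Sum.Base as Sum using (_⊎_; inj₁; inj₂; [_,_]′)
open import Data.Vec.Base using (Vec; []; _∷_; lookup)
open import Function.Base using (_∘_)
open import Relation.Binary.PropositionalEquality
open import Relation.Nullary.Decidable.Core using (Dec; yes; no; decidable-stable)
open import Relation.Nullary.Negation.Core using (¬_; contradiction)
open import Algebra.Properties.Semiring.Sum (CommutativeRing.semiring +-*-commutativeRing) using (sum; sum-cong-≗; sum-replicate-zero; ∑-distrib-+; ∑-comm; *-distribˡ-sum; *-distribʳ-sum)
open import Defs

open ≡-Reasoning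
open +-*-Solver using (Polynomial; var; con; solve; prove; ⟦_⟧; ⟦_⟧↓; _:+_; _:*_; _:-_; :-_; _:=_)

private variable
  j k l N : ℕ

-- Rationals and finite sums

fromℕ-homo-+ : ∀ a b → fromℕ (a ℕ.+ b) ≡ fromℕ a + fromℕ b
fromℕ-homo-+ a b = toℚᵘ-injective (ℚᵘ.≃-trans
  (ℚᵘ.*≡* (cong (ℤ._* ℤ.+ 1) (cong₂ ℤ._+_ (sym (ℤ.*-identityʳ (ℤ.+ a))) (sym (ℤ.*-identityʳ (ℤ.+ b))))))
  (ℚᵘ.≃-sym (toℚᵘ-homo-+ (fromℕ a) (fromℕ b))))

fromℕ-homo-* : ∀ a b → fromℕ (a ℕ.* b) ≡ fromℕ a * fromℕ b
fromℕ-homo-* a b = toℚᵘ-injective (ℚᵘ.≃-trans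
  (ℚᵘ.*≡* (cong (ℤ._* ℤ.+ 1) (ℤ.pos-* a b)))
  (ℚᵘ.≃-sym (toℚᵘ-homo-* (fromℕ a) (fromℕ b))))

fromℕ-injective : ∀ {a b} → fromℕ a ≡ fromℕ b → a ≡ b
fromℕ-injective = ℤ.+-injective ∘ cong ℚ.numerator

fromℕ-nonneg : ∀ a → 0ℚ ≤ fromℕ a
fromℕ-nonneg a = nonNegative⁻¹ (fromℕ a)

*-cancelˡ-zero : ∀ a b → a ≢ 0ℚ → a * b ≡ 0ℚ → b ≡ 0ℚ
*-cancelˡ-zero a b a≢0 ab≡0 = begin
  b                ≡⟨ *-identityˡ b ⟨
  1ℚ * b           ≡⟨ cong (_* b) (*-inverseˡ a) ⟨
  1/ a * a * b     ≡⟨ *-assoc (1/ a) a b ⟩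
  1/ a * (a * b)   ≡⟨ cong (1/ a *_) ab≡0 ⟩
  1/ a * 0ℚ        ≡⟨ *-zeroʳ (1/ a) ⟩
  0ℚ               ∎
  where instance _ = ≢-nonZero a≢0

*-nonneg : ∀ {a b} → 0ℚ ≤ a → 0ℚ ≤ b → 0ℚ ≤ a * b
*-nonneg {a} {b} 0≤a 0≤b = nonNegative⁻¹ (a * b) {{nonNeg*nonNeg⇒nonNeg a {{nonNegative 0≤a}} b {{nonNegative 0≤b}}}}

square-nonneg : ∀ a → 0ℚ ≤ a * a
square-nonneg a with ≤-total 0ℚ a
... | inj₁ 0≤a = *-nonneg 0≤a 0≤a
... | inj₂ a≤0 = subst (0ℚ ≤_) (solve 1 (λ a → :- a :* :- a := a :* a) refl a) (*-nonneg 0≤-a 0≤-a)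
  where
  0≤-a : 0ℚ ≤ - a
  0≤-a = neg-antimono-≤ a≤0

square-zero : ∀ a → a * a ≡ 0ℚ → a ≡ 0ℚ
square-zero a aa≡0 with a ≟ℚ 0ℚ
... | yes a≡0 = a≡0
... | no  a≢0 = *-cancelˡ-zero a a a≢0 aa≡0

a-b≡0⇒a≡b : ∀ a b → a - b ≡ 0ℚ → a ≡ b
a-b≡0⇒a≡b a b a-b≡0 = begin
  a            ≡⟨ solve 2 (λ a b → a := (a :- b) :+ b) refl a b ⟩
  (a - b) + b  ≡⟨ cong (_+ b) a-b≡0 ⟩
  0ℚ + b       ≡⟨ +-identityˡ b ⟩
  b            ∎

+-nonneg-zeroˡ : ∀ {a b} → 0ℚ ≤ a → 0ℚ ≤ b → a + b ≡ 0ℚ → a ≡ 0ℚ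
+-nonneg-zeroˡ {a} {b} 0≤a 0≤b a+b≡0 = ≤-antisym
  (subst₂ _≤_ (+-identityʳ a) a+b≡0 (+-monoʳ-≤ a 0≤b)) 0≤a

sum-zero : {f : Fin k → ℚ} → (∀ i → f i ≡ 0ℚ) → sum f ≡ 0ℚ
sum-zero {k} f≡0 = trans (sum-cong-≗ f≡0) (sum-replicate-zero k)

sum-ones : ∀ k → sum {k} (λ _ → 1ℚ) ≡ fromℕ k
sum-ones zero    = refl
sum-ones (suc k) = trans (cong (1ℚ +_) (sum-ones k)) (sym (fromℕ-homo-+ 1 k))

sum-nonneg : {f : Fin k → ℚ} → (∀ i → 0ℚ ≤ f i) → 0ℚ ≤ sum f
sum-nonneg {zero}  0≤f = ≤-refl
sum-nonneg {suc k} {f} 0≤f = subst (_≤ sum f) (+-identityˡ 0ℚ) (+-mono-≤ (0≤f zero) (sum-nonneg (0≤f ∘ suc)))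

sum-nonneg-zero : {f : Fin k → ℚ} → (∀ i → 0ℚ ≤ f i) → sum f ≡ 0ℚ → ∀ i → f i ≡ 0ℚ
sum-nonneg-zero 0≤f Σf≡0 zero = +-nonneg-zeroˡ (0≤f zero) (sum-nonneg (0≤f ∘ suc)) Σf≡0
sum-nonneg-zero {f = f} 0≤f Σf≡0 (suc i) = sum-nonneg-zero (0≤f ∘ suc)
  (+-nonneg-zeroˡ (sum-nonneg (0≤f ∘ suc)) (0≤f zero) (trans (+-comm _ (f zero)) Σf≡0)) i

sum-neg : (f : Fin k → ℚ) → sum (λ i → - f i) ≡ - sum f
sum-neg {zero}  f = refl
sum-neg {suc k} f = trans (cong (- f zero +_) (sum-neg (f ∘ suc))) (sym (neg-distrib-+ (f zero) (sum (f ∘ suc))))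

sum-- : (f g : Fin k → ℚ) → sum (λ i → f i - g i) ≡ sum f - sum g
sum-- f g = trans (∑-distrib-+ f (λ i → - g i)) (cong (sum f +_) (sum-neg g))

sum-++ : ∀ k {l} (f : Fin (k ℕ.+ l) → ℚ) → sum f ≡ sum (λ i → f (i ↑ˡ l)) + sum (λ i → f (k ↑ʳ i))
sum-++ zero    f = sym (+-identityˡ (sum f))
sum-++ (suc k) f = trans (cong (f zero +_) (sum-++ k (f ∘ suc))) (sym (+-assoc (f zero) _ _))

sum-combine : ∀ k {l} (f : Fin (k ℕ.* l) → ℚ) → sum f ≡ sum (λ i → sum (λ x → f (combine {k} {l} i x)))
sum-combine zero        f = refl
sum-combine (suc k) {l} f = trans (sum-++ l f) (cong (sum (λ x → f (x ↑ˡ k ℕ.* l)) +_) (sum-combine k (λ i → f (l ↑ʳ i))))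

sum-Iˡ : (x : Fin k) (f : Fin k → ℚ) → sum (λ z → I k x z * f z) ≡ f x
sum-Iˡ zero f = trans (cong₂ _+_ (*-identityˡ (f zero)) (sum-zero (λ z → *-zeroˡ (f (suc z))))) (+-identityʳ (f zero))
sum-Iˡ (suc x) f = trans (cong₂ _+_ (*-zeroˡ (f zero)) (sum-Iˡ x (f ∘ suc))) (+-identityˡ (f (suc x)))

I-refl : (x : Fin k) → I k x x ≡ 1ℚ
I-refl x with x ≟ x
... | yes _   = refl
... | no  x≢x = contradiction refl x≢x

I-≢ : {x y : Fin k} → x ≢ y → I k x y ≡ 0ℚ
I-≢ {x = x} {y} x≢y with x ≟ y
... | yes x≡y = contradiction x≡y x≢y
... | no  _   = refl

I≡1⇒≡ : {x y : Fin k} → I k x y ≡ 1ℚ → x ≡ y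
I≡1⇒≡ {x = x} {y} eq with x ≟ y
... | yes x≡y = x≡y
... | no  _   = contradiction (sym eq) 1≢0

zeroOne-nonneg : ∀ {a} → a ≡ 0ℚ ⊎ a ≡ 1ℚ → 0ℚ ≤ a
zeroOne-nonneg (inj₁ refl) = ≤-refl
zeroOne-nonneg (inj₂ refl) = nonNegative⁻¹ 1ℚ

-- Once a term equals 1, the terms after it are nonnegative with sum 0 and so all vanish; a leading
-- 0 leaves the same problem for the tail.
sum≡1⇒indicator : (a : Fin k → ℚ) → (∀ i → a i ≡ 0ℚ ⊎ a i ≡ 1ℚ) → sum a ≡ 1ℚ →
                  ∃[ j ] (∀ i → a i ≡ I k j i)
sum≡1⇒indicator {zero}  a a01 Σa≡1 = contradiction (sym Σa≡1) 1≢0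
sum≡1⇒indicator {suc k} a a01 Σa≡1 with a01 zero
... | inj₂ a₀≡1 = zero , λ { zero → a₀≡1 ; (suc i) → sum-nonneg-zero (zeroOne-nonneg ∘ a01 ∘ suc) rest i }
  where
  rest : sum (a ∘ suc) ≡ 0ℚ
  rest = begin
    sum (a ∘ suc)              ≡⟨ solve 2 (λ a s → s := (a :+ s) :- a) refl (a zero) (sum (a ∘ suc)) ⟩
    a zero + sum (a ∘ suc) - a zero ≡⟨ cong₂ _-_ Σa≡1 a₀≡1 ⟩
    1ℚ - 1ℚ                    ≡⟨⟩
    0ℚ                         ∎
... | inj₁ a₀≡0 with sum≡1⇒indicator (a ∘ suc) (a01 ∘ suc)
                       (trans (sym (+-identityˡ _)) (trans (cong (_+ sum (a ∘ suc)) (sym a₀≡0)) Σa≡1))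
...   | j , a≡I = suc j , λ { zero → a₀≡0 ; (suc i) → a≡I i }

-- Matrix algebra

⊛-cong : {M M′ : Matrix j k} {L L′ : Matrix k l} → M ≋ M′ → L ≋ L′ → M ⊛ L ≋ M′ ⊛ L′
⊛-cong M≋M′ L≋L′ x y = sum-cong-≗ λ z → cong₂ _*_ (M≋M′ x z) (L≋L′ z y)

lincomb-⊛ : (q : Fin N → ℚ) (X : Fin N → Matrix j k) (L : Matrix k l) →
            lincomb q X ⊛ L ≋ lincomb q (λ i → X i ⊛ L)
lincomb-⊛ q X L x y = begin
  sum (λ z → sum (λ i → q i * X i x z) * L z y)   ≡⟨ sum-cong-≗ (λ z → *-distribʳ-sum (L z y) (λ i → q i * X i x z)) ⟩
  sum (λ z → sum (λ i → q i * X i x z * L z y))   ≡⟨ ∑-comm (λ z i → q i * X i x z * L z y) ⟩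
  sum (λ i → sum (λ z → q i * X i x z * L z y))   ≡⟨ sum-cong-≗ (λ i → sum-cong-≗ (λ z → *-assoc (q i) (X i x z) (L z y))) ⟩
  sum (λ i → sum (λ z → q i * (X i x z * L z y))) ≡⟨ sum-cong-≗ (λ i → *-distribˡ-sum (q i) (λ z → X i x z * L z y)) ⟨
  sum (λ i → q i * sum (λ z → X i x z * L z y))   ∎

⊛-ᵗ : (M : Matrix j k) (L : Matrix k l) → (M ⊛ L) ᵗ ≋ L ᵗ ⊛ M ᵗ
⊛-ᵗ M L x y = sum-cong-≗ λ z → *-comm (M y z) (L z x)

-- Transposition carries linearity in the left factor over to the right factor.
⊛-lincomb : (M : Matrix j k) (q : Fin N → ℚ) (X : Fin N → Matrix k l) →
            M ⊛ lincomb q X ≋ lincomb q (λ i → M ⊛ X i)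
⊛-lincomb M q X x y = begin
  (M ⊛ lincomb q X) x y                  ≡⟨ ⊛-ᵗ M (lincomb q X) y x ⟩
  (lincomb q (λ i → X i ᵗ) ⊛ M ᵗ) y x    ≡⟨ lincomb-⊛ q (λ i → X i ᵗ) (M ᵗ) y x ⟩
  lincomb q (λ i → X i ᵗ ⊛ M ᵗ) y x      ≡⟨ sum-cong-≗ (λ i → cong (q i *_) (⊛-ᵗ M (X i) y x)) ⟨
  lincomb q (λ i → M ⊛ X i) x y          ∎

-- Row `x` of `M ⊛ L` is a linear combination of the rows of `L`. With these read as one-row
-- matrices, associativity is an instance of linearity in the left factor.
⊛-assoc : (M : Matrix j k) (L : Matrix k l) (K : Matrix l N) → (M ⊛ L) ⊛ K ≋ M ⊛ (L ⊛ K)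
⊛-assoc M L K x y = lincomb-⊛ (M x) (λ i (_ : Fin 1) → L i) K zero y

⊛-distribˡ-⊞ : (K : Matrix j k) (M L : Matrix k l) → K ⊛ (M ⊞ L) ≋ (K ⊛ M) ⊞ (K ⊛ L)
⊛-distribˡ-⊞ K M L x y = trans (sum-cong-≗ λ z → *-distribˡ-+ (K x z) (M z y) (L z y))
                              (∑-distrib-+ (λ z → K x z * M z y) (λ z → K x z * L z y))

⊡-⊛ : (q : ℚ) (M : Matrix j k) (L : Matrix k l) → (q ⊡ M) ⊛ L ≋ q ⊡ (M ⊛ L)
⊡-⊛ q M L x y = trans (sum-cong-≗ λ z → *-assoc q (M x z) (L z y)) (sym (*-distribˡ-sum q (λ z → M x z * L z y)))

⊛-⊡ : (q : ℚ) (M : Matrix j k) (L : Matrix k l) → M ⊛ (q ⊡ L) ≋ q ⊡ (M ⊛ L)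
⊛-⊡ q M L x y = trans (sum-cong-≗ λ z → solve 3 (λ m q l → m :* (q :* l) := q :* (m :* l)) refl (M x z) q (L z y))
                     (sym (*-distribˡ-sum q (λ z → M x z * L z y)))

lincomb-∈ : (X : Fin k → Matrix j l) (q : Fin N → ℚ) {Y : Fin N → Matrix j l} →
            (∀ i → InSpan X (Y i)) → InSpan X (lincomb q Y)
lincomb-∈ X q {Y} Y∈ = (λ c → sum (λ i → q i * coeff i c)) , λ x y → begin
  sum (λ i → q i * Y i x y)                            ≡⟨ sum-cong-≗ (λ i → cong (q i *_) (proj₂ (Y∈ i) x y)) ⟩
  sum (λ i → q i * sum (λ c → coeff i c * X c x y))    ≡⟨ sum-cong-≗ (λ i → *-distribˡ-sum (q i) (λ c → coeff i c * X c x y)) ⟩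
  sum (λ i → sum (λ c → q i * (coeff i c * X c x y)))  ≡⟨ ∑-comm (λ i c → q i * (coeff i c * X c x y)) ⟩
  sum (λ c → sum (λ i → q i * (coeff i c * X c x y)))  ≡⟨ sum-cong-≗ (λ c → sum-cong-≗ (λ i → *-assoc (q i) (coeff i c) (X c x y))) ⟨
  sum (λ c → sum (λ i → q i * coeff i c * X c x y))    ≡⟨ sum-cong-≗ (λ c → *-distribʳ-sum (X c x y) (λ i → q i * coeff i c)) ⟨
  sum (λ c → sum (λ i → q i * coeff i c) * X c x y)    ∎
  where coeff = λ i → proj₁ (Y∈ i)

⊞-⊡-∈ : (X : Fin k → Matrix j l) {M L : Matrix j l} (q : ℚ) → InSpan X M → InSpan X L → InSpan X (M ⊞ q ⊡ L)
⊞-⊡-∈ X {M} {L} q (a , M≋) (b , L≋) = (λ c → a c + q * b c) , λ x y → begin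
  M x y + q * L x y                                              ≡⟨ cong₂ (λ u v → u + q * v) (M≋ x y) (L≋ x y) ⟩
  sum (λ c → a c * X c x y) + q * sum (λ c → b c * X c x y)      ≡⟨ cong (sum (λ c → a c * X c x y) +_) (*-distribˡ-sum q (λ c → b c * X c x y)) ⟩
  sum (λ c → a c * X c x y) + sum (λ c → q * (b c * X c x y))    ≡⟨ ∑-distrib-+ (λ c → a c * X c x y) (λ c → q * (b c * X c x y)) ⟨
  sum (λ c → a c * X c x y + q * (b c * X c x y))                ≡⟨ sum-cong-≗ (λ c → solve 4 (λ a q b x → a :* x :+ q :* (b :* x) := (a :+ q :* b) :* x) refl (a c) q (b c) (X c x y)) ⟩
  sum (λ c → (a c + q * b c) * X c x y)                          ∎

-- If G is symmetric with G² = aG then |wG|² = a wGwᵗ.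
isotropic⇒kernel : (G : SqMatrix k) (a : ℚ) → G ᵗ ≋ G → G ⊛ G ≋ a ⊡ G →
                   (w : Matrix 1 k) → (∀ y → (w ⊛ G) zero y * w zero y ≡ 0ℚ) → w ⊛ G ≋ O
isotropic⇒kernel G a G-sym G² w wGw≡0 zero y =
  square-zero (v zero y) (sum-nonneg-zero (λ z → square-nonneg (v zero z)) |v|²≡0 y)
  where
  v = w ⊛ G

  vᵗ : v ᵗ ≋ G ⊛ w ᵗ
  vᵗ x z = trans (⊛-ᵗ w G x z) (⊛-cong {L = w ᵗ} G-sym (λ _ _ → refl) x z)

  vG : v ⊛ G ≋ a ⊡ v
  vG x z = begin
    (v ⊛ G) x z          ≡⟨ ⊛-assoc w G G x z ⟩
    (w ⊛ (G ⊛ G)) x z    ≡⟨ ⊛-cong {M = w} (λ _ _ → refl) G² x z ⟩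
    (w ⊛ (a ⊡ G)) x z    ≡⟨ ⊛-⊡ a w G x z ⟩
    (a ⊡ v) x z          ∎

  -- Symmetry of G turns v vᵗ into (vG)wᵗ = a(v wᵗ), and the hypothesis kills every term of v wᵗ.
  |v|²≡0 : sum (λ z → v zero z * v zero z) ≡ 0ℚ
  |v|²≡0 = begin
    (v ⊛ v ᵗ) zero zero              ≡⟨ ⊛-cong {M = v} (λ _ _ → refl) vᵗ zero zero ⟩
    (v ⊛ (G ⊛ w ᵗ)) zero zero        ≡⟨ ⊛-assoc v G (w ᵗ) zero zero ⟨
    ((v ⊛ G) ⊛ w ᵗ) zero zero        ≡⟨ ⊛-cong {L = w ᵗ} vG (λ _ _ → refl) zero zero ⟩
    ((a ⊡ v) ⊛ w ᵗ) zero zero        ≡⟨ ⊡-⊛ a v (w ᵗ) zero zero ⟩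
    a * (v ⊛ w ᵗ) zero zero          ≡⟨ cong (a *_) (sum-zero wGw≡0) ⟩
    a * 0ℚ                           ≡⟨ *-zeroʳ a ⟩
    0ℚ                               ∎

-- The Bose–Mesner algebra

module BoseMesner {d N : ℕ} (S : AssociationScheme d N) where
  open AssociationScheme S

  abstract
    -- For fixed `x` and `y` the entries of the `A i` are 0 or 1 and sum to 1, so the pair lies in
    -- exactly one relation of the scheme.
    onlyClass : ∀ x y → ∃[ c ] (∀ i → A i x y ≡ I (suc d) c i)
    onlyClass x y = sum≡1⇒indicator (λ i → A i x y) (λ i → zeroOne i x y)
      (trans (sum-cong-≗ λ i → sym (*-identityˡ (A i x y))) (partition x y))

  class : Fin N → Fin N → Fin (suc d)
  class x y = proj₁ (onlyClass x y)

  A≡I : ∀ i x y → A i x y ≡ I (suc d) (class x y) i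
  A≡I i x y = proj₂ (onlyClass x y) i

  A≡1⇒class≡ : ∀ i x y → A i x y ≡ 1ℚ → class x y ≡ i
  A≡1⇒class≡ i x y Axy≡1 = I≡1⇒≡ (trans (sym (A≡I i x y)) Axy≡1)

  class-sym : ∀ x y → class x y ≡ class y x
  class-sym x y = sym (A≡1⇒class≡ c y x (trans (symmetric c x y) (trans (A≡I c x y) (I-refl c))))
    where c = class x y

  class-refl : ∀ x → class x x ≡ zero
  class-refl x = A≡1⇒class≡ zero x x (trans (identity x x) (I-refl x))

  I-class : ∀ x y → I (suc d) (class x y) zero ≡ I N x y
  I-class x y = trans (sym (A≡I zero x y)) (identity x y)

  -- The element Σᵢ cᵢ Aᵢ of the Bose–Mesner algebra.
  ⟪_⟫ : (Fin (suc d) → ℚ) → SqMatrix N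
  ⟪ c ⟫ x y = c (class x y)

  ⟪⟫≋lincomb : ∀ c → ⟪ c ⟫ ≋ lincomb c A
  ⟪⟫≋lincomb c x y = begin
    c (class x y)                                ≡⟨ sum-Iˡ (class x y) c ⟨
    sum (λ i → I (suc d) (class x y) i * c i)    ≡⟨ sum-cong-≗ (λ i → trans (cong (_* c i) (sym (A≡I i x y))) (*-comm (A i x y) (c i))) ⟩
    sum (λ i → c i * A i x y)                    ∎

  InAlgebra-⊛ : ∀ {M L} → InAlgebra M → InAlgebra L → InAlgebra (M ⊛ L)
  InAlgebra-⊛ {M} {L} (a , M≋) (b , L≋) = proj₁ ab , λ x y → trans (ML≋ x y) (proj₂ ab x y)
    where
    ab : InAlgebra (lincomb a (λ i → lincomb b (λ j → A i ⊛ A j)))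
    ab = lincomb-∈ A a (λ i → lincomb-∈ A b (closed i))

    ML≋ : M ⊛ L ≋ lincomb a (λ i → lincomb b (λ j → A i ⊛ A j))
    ML≋ x y = begin
      (M ⊛ L) x y                                        ≡⟨ ⊛-cong M≋ L≋ x y ⟩
      (lincomb a A ⊛ lincomb b A) x y                    ≡⟨ lincomb-⊛ a A (lincomb b A) x y ⟩
      lincomb a (λ i → A i ⊛ lincomb b A) x y            ≡⟨ sum-cong-≗ (λ i → cong (a i *_) (⊛-lincomb (A i) b A x y)) ⟩
      lincomb a (λ i → lincomb b (λ j → A i ⊛ A j)) x y  ∎

  InAlgebra⇒symmetric : ∀ {M} → InAlgebra M → M ᵗ ≋ M
  InAlgebra⇒symmetric (a , M≋) x y =
    trans (M≋ y x) (trans (sum-cong-≗ λ i → cong (a i *_) (symmetric i x y)) (sym (M≋ x y)))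

  -- All members of the algebra, products included, are symmetric, so ML = (ML)ᵗ = LᵗMᵗ = LM.
  ⊛-comm : ∀ {M L} → InAlgebra M → InAlgebra L → M ⊛ L ≋ L ⊛ M
  ⊛-comm {M} {L} M∈ L∈ x y = begin
    (M ⊛ L) x y       ≡⟨ InAlgebra⇒symmetric (InAlgebra-⊛ M∈ L∈) x y ⟨
    (M ⊛ L) y x       ≡⟨ ⊛-ᵗ M L x y ⟩
    (L ᵗ ⊛ M ᵗ) x y   ≡⟨ ⊛-cong (InAlgebra⇒symmetric L∈) (InAlgebra⇒symmetric M∈) x y ⟩
    (L ⊛ M) x y       ∎

  -- For commuting idempotents e = ef + (e − ef) is an orthogonal decomposition.
  primitive-absorbs : ∀ {e f} → IsPrimitiveIdempotent e → IsIdempotent f → e ⊛ f ≋ O ⊎ e ≋ e ⊛ f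
  primitive-absorbs {e} {f} e-prim f-idem = Sum.map₂ (λ r≋O x y → a-b≡0⇒a≡b (e x y) (p x y) (trans (r-entry x y) (r≋O x y)))
    (IsPrimitiveIdempotent.indecomposable e-prim p r
      (record { inAlgebra = p∈ ; idempotent = pp })
      (record { inAlgebra = r∈ ; idempotent = rr }) pr rp
      (λ x y → solve 2 (λ e p → e := p :+ (e :+ con (- 1ℚ) :* p)) refl (e x y) (p x y)))
    where
    open IsPrimitiveIdempotent e-prim using (isIdempotent)
    open IsIdempotent isIdempotent renaming (inAlgebra to e∈; idempotent to ee)
    open IsIdempotent f-idem renaming (inAlgebra to f∈; idempotent to ff)
    p r : SqMatrix N
    p = e ⊛ f
    r = e ⊞ (- 1ℚ) ⊡ p
    p∈ : InAlgebra p
    p∈ = InAlgebra-⊛ e∈ f∈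
    r∈ : InAlgebra r
    r∈ = ⊞-⊡-∈ A (- 1ℚ) e∈ p∈

    r-entry : ∀ x y → e x y - p x y ≡ r x y
    r-entry x y = solve 2 (λ a b → a :- b := a :+ con (- 1ℚ) :* b) refl (e x y) (p x y)

    ep : e ⊛ p ≋ p
    ep x y = trans (sym (⊛-assoc e e f x y)) (⊛-cong {L = f} ee (λ _ _ → refl) x y)

    pe : p ⊛ e ≋ p
    pe x y = trans (⊛-comm p∈ e∈ x y) (ep x y)

    pp : p ⊛ p ≋ p
    pp x y = begin
      (p ⊛ (e ⊛ f)) x y   ≡⟨ ⊛-assoc p e f x y ⟨
      ((p ⊛ e) ⊛ f) x y   ≡⟨ ⊛-cong {L = f} pe (λ _ _ → refl) x y ⟩
      ((e ⊛ f) ⊛ f) x y   ≡⟨ ⊛-assoc e f f x y ⟩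
      (e ⊛ (f ⊛ f)) x y   ≡⟨ ⊛-cong {M = e} (λ _ _ → refl) ff x y ⟩
      p x y               ∎

    ⊛r : ∀ M x y → (M ⊛ r) x y ≡ (M ⊛ e) x y - (M ⊛ p) x y
    ⊛r M x y = begin
      (M ⊛ r) x y                                 ≡⟨ ⊛-distribˡ-⊞ M e ((- 1ℚ) ⊡ p) x y ⟩
      (M ⊛ e) x y + (M ⊛ ((- 1ℚ) ⊡ p)) x y        ≡⟨ cong ((M ⊛ e) x y +_) (⊛-⊡ (- 1ℚ) M p x y) ⟩
      (M ⊛ e) x y + - 1ℚ * (M ⊛ p) x y            ≡⟨ solve 2 (λ a b → a :+ con (- 1ℚ) :* b := a :- b) refl ((M ⊛ e) x y) ((M ⊛ p) x y) ⟩
      (M ⊛ e) x y - (M ⊛ p) x y                   ∎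

    pr : p ⊛ r ≋ O
    pr x y = trans (⊛r p x y) (trans (cong₂ _-_ (pe x y) (pp x y)) (+-inverseʳ (p x y)))

    rp : r ⊛ p ≋ O
    rp x y = trans (⊛-comm r∈ p∈ x y) (pr x y)

    re : r ⊛ e ≋ r
    re x y = begin
      (r ⊛ e) x y                 ≡⟨ ⊛-comm r∈ e∈ x y ⟩
      (e ⊛ r) x y                 ≡⟨ ⊛r e x y ⟩
      (e ⊛ e) x y - (e ⊛ p) x y   ≡⟨ cong₂ _-_ (ee x y) (ep x y) ⟩
      e x y - p x y               ≡⟨ r-entry x y ⟩
      r x y                       ∎

    rr : r ⊛ r ≋ r
    rr x y = begin
      (r ⊛ r) x y                 ≡⟨ ⊛r r x y ⟩
      (r ⊛ e) x y - (r ⊛ p) x y   ≡⟨ cong₂ _-_ (re x y) (rp x y) ⟩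
      r x y - 0ℚ                  ≡⟨ +-identityʳ (r x y) ⟩
      r x y                       ∎

  -- Orthogonality of the primitive idempotents and multiplication through eigenvalues

  module _ {E : Fin (suc d) → SqMatrix N} (E-basis : IsPrimitiveIdempotentBasis E) where
    open IsPrimitiveIdempotentBasis E-basis

    E-idempotent : ∀ i → IsIdempotent (E i)
    E-idempotent i = IsPrimitiveIdempotent.isIdempotent (isPrimitive i)

    -- Equality would give the linear relation with coefficient vector δᵢ - δⱼ, whose value at `i`
    -- is 1.
    E-distinct : ∀ {i j} → i ≢ j → ¬ (E i ≋ E j)
    E-distinct {i} {j} i≢j Ei≋Ej = contradiction (begin
      1ℚ                                   ≡⟨⟩
      1ℚ - 0ℚ                              ≡⟨ cong₂ _-_ (I-refl i) (I-≢ (i≢j ∘ sym)) ⟨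
      I (suc d) i i - I (suc d) j i        ≡⟨ independent (λ k → I (suc d) i k - I (suc d) j k) dependence i ⟩
      0ℚ                                   ∎) 1≢0
      where
      dependence : lincomb (λ k → I (suc d) i k - I (suc d) j k) E ≋ O
      dependence x y = begin
        sum (λ k → (I (suc d) i k - I (suc d) j k) * E k x y)
          ≡⟨ sum-cong-≗ (λ k → solve 3 (λ a b e → (a :- b) :* e := a :* e :- b :* e) refl (I (suc d) i k) (I (suc d) j k) (E k x y)) ⟩
        sum (λ k → I (suc d) i k * E k x y - I (suc d) j k * E k x y)
          ≡⟨ sum-- (λ k → I (suc d) i k * E k x y) (λ k → I (suc d) j k * E k x y) ⟩
        sum (λ k → I (suc d) i k * E k x y) - sum (λ k → I (suc d) j k * E k x y)
          ≡⟨ cong₂ _-_ (sum-Iˡ i (λ k → E k x y)) (sum-Iˡ j (λ k → E k x y)) ⟩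
        E i x y - E j x y
          ≡⟨ cong (_- E j x y) (Ei≋Ej x y) ⟩
        E j x y - E j x y
          ≡⟨ +-inverseʳ (E j x y) ⟩
        0ℚ ∎

    -- Absorption is applied in both directions: a nonzero product would give Eᵢ = EᵢEⱼ = EⱼEᵢ = Eⱼ.
    E-orthogonal : ∀ {i j} → i ≢ j → E i ⊛ E j ≋ O
    E-orthogonal {i} {j} i≢j = [ (λ EiEj≋O → EiEj≋O) , (λ Ei≋EiEj →
        [ (λ EjEi≋O x y → trans (comm x y) (EjEi≋O x y))
        , (λ Ej≋EjEi → contradiction (λ x y → trans (Ei≋EiEj x y) (trans (comm x y) (sym (Ej≋EjEi x y)))) (E-distinct i≢j))
        ]′ (primitive-absorbs (isPrimitive j) (E-idempotent i)))
      ]′ (primitive-absorbs (isPrimitive i) (E-idempotent j))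
      where
      comm : E i ⊛ E j ≋ E j ⊛ E i
      comm = ⊛-comm {E i} {E j} (IsIdempotent.inAlgebra (E-idempotent i)) (IsIdempotent.inAlgebra (E-idempotent j))

    EE : ∀ i j → E i ⊛ E j ≋ I (suc d) i j ⊡ E i
    EE i j x y with i ≟ j
    ... | yes refl = trans (IsIdempotent.idempotent (E-idempotent i) x y) (sym (*-identityˡ (E i x y)))
    ... | no  i≢j  = trans (E-orthogonal i≢j x y) (sym (*-zeroˡ (E i x y)))

    lincomb-E-⊛ : ∀ a b → lincomb a E ⊛ lincomb b E ≋ lincomb (λ i → a i * b i) E
    lincomb-E-⊛ a b x y = begin
      (lincomb a E ⊛ lincomb b E) x y
        ≡⟨ lincomb-⊛ a E (lincomb b E) x y ⟩
      sum (λ i → a i * (E i ⊛ lincomb b E) x y)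
        ≡⟨ sum-cong-≗ (λ i → cong (a i *_) (⊛-lincomb (E i) b E x y)) ⟩
      sum (λ i → a i * sum (λ j → b j * (E i ⊛ E j) x y))
        ≡⟨ sum-cong-≗ (λ i → cong (a i *_) (sum-cong-≗ (λ j → trans (cong (b j *_) (EE i j x y))
             (solve 3 (λ b δ e → b :* (δ :* e) := δ :* (b :* e)) refl (b j) (I (suc d) i j) (E i x y))))) ⟩
      sum (λ i → a i * sum (λ j → I (suc d) i j * (b j * E i x y)))
        ≡⟨ sum-cong-≗ (λ i → cong (a i *_) (sum-Iˡ i (λ j → b j * E i x y))) ⟩
      sum (λ i → a i * (b i * E i x y))
        ≡⟨ sum-cong-≗ (λ i → *-assoc (a i) (b i) (E i x y)) ⟨
      sum (λ i → a i * b i * E i x y) ∎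

    module _ (P : SqMatrix (suc d)) (P-eigen : IsFirstEigenmatrix E P) where

      -- The eigenvalue of `⟪ c ⟫` on the image of the `i`-th idempotent.
      eigenvalue : (Fin (suc d) → ℚ) → Fin (suc d) → ℚ
      eigenvalue c i = sum (λ j → P i j * c j)

      ⟪⟫≋lincomb-E : ∀ c → ⟪ c ⟫ ≋ lincomb (eigenvalue c) E
      ⟪⟫≋lincomb-E c x y = begin
        c (class x y)                                      ≡⟨ ⟪⟫≋lincomb c x y ⟩
        sum (λ j → c j * A j x y)                          ≡⟨ sum-cong-≗ (λ j → cong (c j *_) (P-eigen j x y)) ⟩
        sum (λ j → c j * sum (λ i → P i j * E i x y))      ≡⟨ sum-cong-≗ (λ j → *-distribˡ-sum (c j) (λ i → P i j * E i x y)) ⟩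
        sum (λ j → sum (λ i → c j * (P i j * E i x y)))    ≡⟨ ∑-comm (λ j i → c j * (P i j * E i x y)) ⟩
        sum (λ i → sum (λ j → c j * (P i j * E i x y)))    ≡⟨ sum-cong-≗ (λ i → sum-cong-≗ (λ j → solve 3 (λ c p e → c :* (p :* e) := p :* c :* e) refl (c j) (P i j) (E i x y))) ⟩
        sum (λ i → sum (λ j → P i j * c j * E i x y))      ≡⟨ sum-cong-≗ (λ i → *-distribʳ-sum (E i x y) (λ j → P i j * c j)) ⟨
        sum (λ i → eigenvalue c i * E i x y)               ∎

      -- Reduces a matrix identity in the algebra to one scalar identity per idempotent. All matrix
      -- products taken from the scheme are computed in this way.
      ⟪⟫-⊛ : ∀ a b c → (∀ i → eigenvalue a i * eigenvalue b i ≡ eigenvalue c i) → ⟪ a ⟫ ⊛ ⟪ b ⟫ ≋ ⟪ c ⟫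
      ⟪⟫-⊛ a b c ab≡c x y = begin
        (⟪ a ⟫ ⊛ ⟪ b ⟫) x y                                        ≡⟨ ⊛-cong (⟪⟫≋lincomb-E a) (⟪⟫≋lincomb-E b) x y ⟩
        (lincomb (eigenvalue a) E ⊛ lincomb (eigenvalue b) E) x y  ≡⟨ lincomb-E-⊛ (eigenvalue a) (eigenvalue b) x y ⟩
        sum (λ i → eigenvalue a i * eigenvalue b i * E i x y)      ≡⟨ sum-cong-≗ (λ i → cong (_* E i x y) (ab≡c i)) ⟩
        lincomb (eigenvalue c) E x y                               ≡⟨ ⟪⟫≋lincomb-E c x y ⟨
        ⟪ c ⟫ x y                                                  ∎

-- Equivalence relations with classes of equal size

𝟙 : Bool → ℚ
𝟙 b = if b then 1ℚ else 0ℚ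

𝟙-zeroOne : ∀ b → 𝟙 b ≡ 0ℚ ⊎ 𝟙 b ≡ 1ℚ
𝟙-zeroOne true  = inj₂ refl
𝟙-zeroOne false = inj₁ refl

𝟙≡0⇒false : ∀ b → 𝟙 b ≡ 0ℚ → b ≡ false
𝟙≡0⇒false true  1≡0 = contradiction 1≡0 1≢0
𝟙≡0⇒false false _   = refl

𝟙-∧ : ∀ a b → 𝟙 (a ∧ b) ≡ 𝟙 a * 𝟙 b
𝟙-∧ true  b = sym (*-identityˡ (𝟙 b))
𝟙-∧ false b = sym (*-zeroˡ (𝟙 b))

∧-true : ∀ {a b} → a ∧ b ≡ true → a ≡ true × b ≡ true
∧-true {true} b≡true = refl , b≡true

-- Completeness of the list is expressed by `sum-elem`, a change of summation index, since sums over
-- cells are what it serves.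
record Enumeration (p : Fin N → Bool) (k : ℕ) : Set where
  field
    elem           : Fin k → Fin N
    elem-∈         : ∀ i → p (elem i) ≡ true
    elem-injective : ∀ {i j} → elem i ≡ elem j → i ≡ j
    sum-elem       : ∀ f → sum (f ∘ elem) ≡ sum (λ v → 𝟙 (p v) * f v)

enumerate : (p : Fin N → Bool) → ∃[ k ] Enumeration p k
enumerate {zero}  p = zero , record { elem = λ () ; elem-∈ = λ () ; elem-injective = λ {} ; sum-elem = λ _ → refl }
enumerate {suc N} p with enumerate (p ∘ suc) | p zero in p₀
... | k , e | true  = suc k , record
  { elem           = λ { zero → zero ; (suc i) → suc (elem i) }
  ; elem-∈         = λ { zero → p₀ ; (suc i) → elem-∈ i }
  ; elem-injective = λ { {zero} {zero} _ → refl ; {suc i} {suc j} eq → cong suc (elem-injective (suc-injective eq)) }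
  ; sum-elem       = λ f → cong₂ _+_ (sym (trans (cong (λ b → 𝟙 b * f zero) p₀) (*-identityˡ (f zero)))) (sum-elem (f ∘ suc))
  } where open Enumeration e
... | k , e | false = k , record
  { elem           = suc ∘ elem
  ; elem-∈         = elem-∈
  ; elem-injective = elem-injective ∘ suc-injective
  ; sum-elem       = λ f → trans (sum-elem (f ∘ suc)) (sym (trans
      (cong (_+ sum (λ v → 𝟙 (p (suc v)) * f (suc v))) (trans (cong (λ b → 𝟙 b * f zero) p₀) (*-zeroˡ (f zero)))) (+-identityˡ _)))
  } where open Enumeration e

-- Summing the constant 1 over the enumeration identifies its length with the given cardinality.
enumerateExactly : (p : Fin N → Bool) → ∀ k → sum (𝟙 ∘ p) ≡ fromℕ k → Enumeration p k
enumerateExactly p k |p|≡k with enumerate p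
... | k′ , e = subst (Enumeration p) (fromℕ-injective (begin
  fromℕ k′                    ≡⟨ sum-ones k′ ⟨
  sum {k′} (λ _ → 1ℚ)         ≡⟨ Enumeration.sum-elem e (λ _ → 1ℚ) ⟩
  sum (λ v → 𝟙 (p v) * 1ℚ)    ≡⟨ sum-cong-≗ (λ v → *-identityʳ (𝟙 (p v))) ⟩
  sum (𝟙 ∘ p)                 ≡⟨ |p|≡k ⟩
  fromℕ k                     ∎)) e

record Transversal (rel : Fin N → Fin N → Bool) (l : ℕ) : Set where
  field
    rep     : Fin l → Fin N
    covered : ∀ v → sum (λ i → 𝟙 (rel (rep i) v)) ≡ 1ℚ

  -- `rep j` is related to exactly one representative, and by reflexivity that is `rep j` itself.
  separated : (∀ x → rel x x ≡ true) → ∀ {i j} → i ≢ j → rel (rep i) (rep j) ≡ false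
  separated rel-refl {i} {j} i≢j with sum≡1⇒indicator (λ i → 𝟙 (rel (rep i) (rep j))) (λ i → 𝟙-zeroOne _) (covered (rep j))
  ... | c , is-c = 𝟙≡0⇒false _ (trans (is-c i) (I-≢ (λ c≡i → i≢j (trans (sym c≡i) c≡j))))
    where
    c≡j : c ≡ j
    c≡j = I≡1⇒≡ (trans (sym (is-c j)) (cong 𝟙 (rel-refl (rep j))))

-- A reflexive symmetric 0/1 matrix which is proportional to an idempotent is an
-- equivalence relation whose classes all have the same size.
module Uniform (rel : Fin N → Fin N → Bool) (k : ℚ)
  (rel-refl : ∀ x → rel x x ≡ true) (rel-sym : ∀ x y → rel x y ≡ rel y x)
  (rel-square : ∀ x y → sum (λ z → 𝟙 (rel x z) * 𝟙 (rel z y)) ≡ k * 𝟙 (rel x y)) where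

  -- For a symmetric 0/1 matrix R, the row sum at `x` is the diagonal entry of R² = kR.
  classSize : ∀ x → sum (λ z → 𝟙 (rel x z)) ≡ k
  classSize x = begin
    sum (λ z → 𝟙 (rel x z))               ≡⟨ sum-cong-≗ (λ z → trans (idem (rel x z)) (cong (λ b → 𝟙 (rel x z) * 𝟙 b) (rel-sym x z))) ⟩
    sum (λ z → 𝟙 (rel x z) * 𝟙 (rel z x)) ≡⟨ rel-square x x ⟩
    k * 𝟙 (rel x x)                       ≡⟨ cong (λ b → k * 𝟙 b) (rel-refl x) ⟩
    k * 1ℚ                                ≡⟨ *-identityʳ k ⟩
    k                                     ∎
    where
    idem : ∀ b → 𝟙 b ≡ 𝟙 b * 𝟙 b
    idem true  = refl
    idem false = refl

  -- Row `x` sums to `k`, and so do its terms restricted to the vertices related to `y`, this being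
  -- the entry of the square at a related pair. The nonnegative differences sum to 0, hence each of
  -- them vanishes, in particular the one at `z`.
  rel-euclidean : ∀ {x y z} → rel x z ≡ true → rel x y ≡ true → rel z y ≡ true
  rel-euclidean {x} {y} {z} xz xy = conclude (rel z y) (begin
    1ℚ - 1ℚ * 𝟙 (rel z y)                      ≡⟨ cong (λ b → 𝟙 b - 𝟙 b * 𝟙 (rel z y)) xz ⟨
    𝟙 (rel x z) - 𝟙 (rel x z) * 𝟙 (rel z y)    ≡⟨ sum-nonneg-zero (λ w → nonneg (rel x w) (rel w y)) total z ⟩
    0ℚ                                         ∎)
    where
    nonneg : ∀ a b → 0ℚ ≤ 𝟙 a - 𝟙 a * 𝟙 b
    nonneg true  true  = ≤-refl
    nonneg true  false = nonNegative⁻¹ 1ℚ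
    nonneg false true  = ≤-refl
    nonneg false false = ≤-refl

    conclude : ∀ b → 1ℚ - 1ℚ * 𝟙 b ≡ 0ℚ → b ≡ true
    conclude true  _   = refl
    conclude false 1≡0 = contradiction 1≡0 1≢0

    total : sum (λ w → 𝟙 (rel x w) - 𝟙 (rel x w) * 𝟙 (rel w y)) ≡ 0ℚ
    total = begin
      sum (λ w → 𝟙 (rel x w) - 𝟙 (rel x w) * 𝟙 (rel w y))             ≡⟨ sum-- (λ w → 𝟙 (rel x w)) (λ w → 𝟙 (rel x w) * 𝟙 (rel w y)) ⟩
      sum (λ w → 𝟙 (rel x w)) - sum (λ w → 𝟙 (rel x w) * 𝟙 (rel w y)) ≡⟨ cong₂ _-_ (classSize x) (rel-square x y) ⟩
      k - k * 𝟙 (rel x y)                                             ≡⟨ cong (λ b → k - k * 𝟙 b) xy ⟩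
      k - k * 1ℚ                                                      ≡⟨ solve 1 (λ k → k :- k :* con 1ℚ := con 0ℚ) refl k ⟩
      0ℚ                                                              ∎

  rel-cong : ∀ {x z} → rel x z ≡ true → ∀ y → rel x y ≡ rel z y
  rel-cong {x} {z} xz y with rel x y in xy | rel z y in zy
  ... | true  | true  = refl
  ... | false | false = refl
  ... | true  | false = trans (sym (rel-euclidean xz xy)) zy
  ... | false | true  = trans (sym xy) (rel-euclidean (trans (rel-sym z x) xz) zy)

  private
    cover : (Fin l → Fin N) → Fin N → ℚ
    cover r v = sum (λ i → 𝟙 (rel (r i) v))

    total-cover : ∀ l (r : Fin l → Fin N) → sum (cover r) ≡ fromℕ l * k
    total-cover l r = begin
      sum (λ v → sum (λ i → 𝟙 (rel (r i) v)))   ≡⟨ ∑-comm (λ v i → 𝟙 (rel (r i) v)) ⟩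
      sum (λ i → sum (λ v → 𝟙 (rel (r i) v)))   ≡⟨ sum-cong-≗ (λ i → trans (classSize (r i)) (sym (*-identityˡ k))) ⟩
      sum {l} (λ i → 1ℚ * k)                    ≡⟨ *-distribʳ-sum {l} k (λ _ → 1ℚ) ⟨
      sum {l} (λ _ → 1ℚ) * k                    ≡⟨ cong (_* k) (sum-ones l) ⟩
      fromℕ l * k                               ∎

    -- Representatives of pairwise different classes: no vertex is covered twice.
    Packing : ℕ → Set
    Packing l = ∃[ r ] (∀ v → cover {l} r v ≡ 0ℚ ⊎ cover r v ≡ 1ℚ)

    -- If every vertex were covered once, double counting would give lk = N. So some vertex is
    -- uncovered and can serve as a new representative.
    extend : ∀ l → Packing l → fromℕ l * k ≢ fromℕ N → Packing (suc l)
    extend l (r , 0or1) lk≢N with all? (λ v → cover r v ≟ℚ 1ℚ)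
    ... | yes all-1 = contradiction (begin
      fromℕ l * k            ≡⟨ total-cover l r ⟨
      sum (cover r)          ≡⟨ sum-cong-≗ all-1 ⟩
      sum {N} (λ _ → 1ℚ)     ≡⟨ sum-ones N ⟩
      fromℕ N                ∎) lk≢N
    ... | no  not-all with ¬∀⟶∃¬ N _ (λ v → cover r v ≟ℚ 1ℚ) not-all
    ...   | new , cover≢1 = r⁺ , 0or1⁺
      where
      cover≡0 : cover r new ≡ 0ℚ
      cover≡0 = [ (λ eq → eq) , (λ eq → contradiction eq cover≢1) ]′ (0or1 new)

      r⁺ : Fin (suc l) → Fin N
      r⁺ zero    = new
      r⁺ (suc i) = r i

      0or1⁺ : ∀ v → cover r⁺ v ≡ 0ℚ ⊎ cover r⁺ v ≡ 1ℚ
      0or1⁺ v with rel new v in new~v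
      ... | false = Sum.map (trans (+-identityˡ _)) (trans (+-identityˡ _)) (0or1 v)
      -- Here `v` lies in the class of `new`, so the old representatives cover it as often as they
      -- cover `new`, that is, not at all.
      ... | true  = inj₂ (begin
        1ℚ + cover r v     ≡⟨ cong (1ℚ +_) (sum-cong-≗ (λ i → cong 𝟙 (trans (rel-sym (r i) v) (trans (sym (rel-cong new~v (r i))) (rel-sym new (r i)))))) ⟩
        1ℚ + cover r new   ≡⟨ cong (1ℚ +_) cover≡0 ⟩
        1ℚ + 0ℚ            ≡⟨⟩
        1ℚ                 ∎)

  -- The greedy packing cannot stop before `l` steps, since i < l and k ≠ 0 give ik ≠ N. After `l`
  -- steps the nonnegative defects 1 - `cover` sum to N - lk = 0, so every vertex is covered exactly
  -- once.
  transversal : ∀ l → k ≢ 0ℚ → fromℕ l * k ≡ fromℕ N → Transversal rel l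
  transversal l k≢0 lk≡N = record { rep = proj₁ full ; covered = λ v → sym (a-b≡0⇒a≡b 1ℚ _ (sum-nonneg-zero nonneg total v)) }
    where
    pack : ∀ i → i ℕ.≤ l → Packing i
    pack zero    _   = (λ ()) , λ _ → inj₁ refl
    pack (suc i) i<l = extend i (pack i (ℕ.<⇒≤ i<l)) λ ik≡N → ℕ.<⇒≢ i<l (fromℕ-injective
      (a-b≡0⇒a≡b _ _ (*-cancelˡ-zero k _ k≢0 (begin
        k * (fromℕ i - fromℕ l)        ≡⟨ solve 3 (λ k i l → k :* (i :- l) := i :* k :- l :* k) refl k (fromℕ i) (fromℕ l) ⟩
        fromℕ i * k - fromℕ l * k      ≡⟨ cong₂ _-_ ik≡N lk≡N ⟩
        fromℕ N - fromℕ N              ≡⟨ +-inverseʳ (fromℕ N) ⟩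
        0ℚ                             ∎))))

    full : Packing l
    full = pack l ℕ.≤-refl

    nonneg : ∀ v → 0ℚ ≤ 1ℚ - cover (proj₁ full) v
    nonneg v = [ (λ eq → subst (λ a → 0ℚ ≤ 1ℚ - a) (sym eq) (nonNegative⁻¹ 1ℚ)) , (λ eq → subst (λ a → 0ℚ ≤ 1ℚ - a) (sym eq) ≤-refl) ]′ (proj₂ full v)

    total : sum (λ v → 1ℚ - cover (proj₁ full) v) ≡ 0ℚ
    total = begin
      sum (λ v → 1ℚ - cover (proj₁ full) v)          ≡⟨ sum-- (λ _ → 1ℚ) (cover (proj₁ full)) ⟩
      sum {N} (λ _ → 1ℚ) - sum (cover (proj₁ full))  ≡⟨ cong₂ _-_ (sum-ones N) (trans (total-cover l (proj₁ full)) lk≡N) ⟩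
      fromℕ N - fromℕ N                              ≡⟨ +-inverseʳ (fromℕ N) ⟩
      0ℚ                                             ∎

-- Eigenvalues of the relevant elements of the Bose–Mesner algebra

-- The coefficient vectors of B, of D and of A₀ + A₁.
inGroup inLayer inCell : Fin 6 → Bool
inGroup = lookup (true ∷ true ∷ true  ∷ false ∷ false ∷ false ∷ [])
inLayer = lookup (true ∷ true ∷ false ∷ true  ∷ false ∷ false ∷ [])
inCell c = inGroup c ∧ inLayer c

gramCoefficient : ℚ → Fin 6 → ℚ
gramCoefficient κ = lookup (κ ∷ 0ℚ ∷ 0ℚ ∷ 1ℚ ∷ 1ℚ ∷ - 1ℚ ∷ [])

module Eigenvalues (n′ m′ : ℕ) where

  -- κ = 2n is the size of a cell. Λ = 2n(m + 1) is both the size of a layer and the only nonzero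
  -- eigenvalue of G.
  κ Λ : ℚ
  κ = fromℕ 2 * fromℕ n′
  Λ = κ * (fromℕ m′ + 1ℚ)

  eigenvalueOf : (Fin 6 → ℚ) → Fin 6 → ℚ
  eigenvalueOf c i = sum (λ j → P n′ m′ i j * c j)

  private
    n m 0ᵖ 1ᵖ κᵖ Λᵖ v : Polynomial 2
    n = var 0F
    m = var 1F
    0ᵖ = con 0ℚ
    1ᵖ = con 1ℚ
    κᵖ = con (fromℕ 2) :* n
    Λᵖ = κᵖ :* (m :+ 1ᵖ)
    v = n :* (κᵖ :- 1ᵖ)

    -- The matrix `P` over polynomials in n and m. Evaluation at `ρ` returns its entries by
    -- computation, so identities between eigenvalues become polynomial identities.
    Pᵖ : Vec (Vec (Polynomial 2) 6) 6
    Pᵖ =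
      (1ᵖ ∷ κᵖ :- 1ᵖ ∷ κᵖ :* (κᵖ :- 1ᵖ) ∷ κᵖ :* m ∷ v :* m      ∷ v :* m      ∷ []) ∷
      (1ᵖ ∷ :- 1ᵖ    ∷ 0ᵖ               ∷ 0ᵖ      ∷ n :* m      ∷ :- (n :* m) ∷ []) ∷
      (1ᵖ ∷ κᵖ :- 1ᵖ ∷ :- κᵖ            ∷ κᵖ :* m ∷ :- (n :* m) ∷ :- (n :* m) ∷ []) ∷
      (1ᵖ ∷ κᵖ :- 1ᵖ ∷ :- κᵖ            ∷ :- κᵖ   ∷ n           ∷ n           ∷ []) ∷
      (1ᵖ ∷ :- 1ᵖ    ∷ 0ᵖ               ∷ 0ᵖ      ∷ :- n        ∷ n           ∷ []) ∷
      (1ᵖ ∷ κᵖ :- 1ᵖ ∷ κᵖ :* (κᵖ :- 1ᵖ) ∷ :- κᵖ   ∷ :- v        ∷ :- v        ∷ []) ∷ []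

    eigenvalueᵖ : (Fin 6 → Polynomial 2) → Fin 6 → Polynomial 2
    eigenvalueᵖ c i = entry 0F :+ (entry 1F :+ (entry 2F :+ (entry 3F :+ (entry 4F :+ (entry 5F :+ 0ᵖ)))))
      where entry = λ j → lookup (lookup Pᵖ i) j :* c j

    indicatorᵖ : (Fin 6 → Bool) → Fin 6 → Polynomial 2
    indicatorᵖ p c = con (𝟙 (p c))

    gramᵖ : Fin 6 → Polynomial 2
    gramᵖ = lookup (κᵖ ∷ 0ᵖ ∷ 0ᵖ ∷ 1ᵖ ∷ 1ᵖ ∷ :- 1ᵖ ∷ [])

    ρ : Vec ℚ 2
    ρ = fromℕ n′ ∷ fromℕ m′ ∷ []

    row : (a b c : Fin 6 → Polynomial 2) (i : Fin 6) →
          ⟦ eigenvalueᵖ a i :* eigenvalueᵖ b i ⟧↓ ρ ≡ ⟦ eigenvalueᵖ c i ⟧↓ ρ →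
          ⟦ eigenvalueᵖ a i :* eigenvalueᵖ b i ⟧ ρ ≡ ⟦ eigenvalueᵖ c i ⟧ ρ
    row a b c i = prove ρ (eigenvalueᵖ a i :* eigenvalueᵖ b i) (eigenvalueᵖ c i)

  group-group : ∀ i → eigenvalueOf (𝟙 ∘ inGroup) i * eigenvalueOf (𝟙 ∘ inGroup) i ≡ eigenvalueOf (λ c → κ * κ * 𝟙 (inGroup c)) i
  group-group = λ { 0F → rowᵢ 0F refl ; 1F → rowᵢ 1F refl ; 2F → rowᵢ 2F refl ; 3F → rowᵢ 3F refl ; 4F → rowᵢ 4F refl ; 5F → rowᵢ 5F refl }
    where rowᵢ = row (indicatorᵖ inGroup) (indicatorᵖ inGroup) (λ c → κᵖ :* κᵖ :* indicatorᵖ inGroup c)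

  layer-layer : ∀ i → eigenvalueOf (𝟙 ∘ inLayer) i * eigenvalueOf (𝟙 ∘ inLayer) i ≡ eigenvalueOf (λ c → Λ * 𝟙 (inLayer c)) i
  layer-layer = λ { 0F → rowᵢ 0F refl ; 1F → rowᵢ 1F refl ; 2F → rowᵢ 2F refl ; 3F → rowᵢ 3F refl ; 4F → rowᵢ 4F refl ; 5F → rowᵢ 5F refl }
    where rowᵢ = row (indicatorᵖ inLayer) (indicatorᵖ inLayer) (λ c → Λᵖ :* indicatorᵖ inLayer c)

  group-layer : ∀ i → eigenvalueOf (𝟙 ∘ inGroup) i * eigenvalueOf (𝟙 ∘ inLayer) i ≡ eigenvalueOf (λ _ → κ) i
  group-layer = λ { 0F → rowᵢ 0F refl ; 1F → rowᵢ 1F refl ; 2F → rowᵢ 2F refl ; 3F → rowᵢ 3F refl ; 4F → rowᵢ 4F refl ; 5F → rowᵢ 5F refl }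
    where rowᵢ = row (indicatorᵖ inGroup) (indicatorᵖ inLayer) (λ _ → κᵖ)

  gram-gram : ∀ i → eigenvalueOf (gramCoefficient κ) i * eigenvalueOf (gramCoefficient κ) i ≡ eigenvalueOf (λ c → Λ * gramCoefficient κ c) i
  gram-gram = λ { 0F → rowᵢ 0F refl ; 1F → rowᵢ 1F refl ; 2F → rowᵢ 2F refl ; 3F → rowᵢ 3F refl ; 4F → rowᵢ 4F refl ; 5F → rowᵢ 5F refl }
    where rowᵢ = row gramᵖ gramᵖ (λ c → Λᵖ :* gramᵖ c)

  gram-cell : ∀ i → eigenvalueOf (gramCoefficient κ) i * eigenvalueOf (𝟙 ∘ inCell) i ≡ eigenvalueOf (λ c → κ * 𝟙 (inLayer c)) i
  gram-cell = λ { 0F → rowᵢ 0F refl ; 1F → rowᵢ 1F refl ; 2F → rowᵢ 2F refl ; 3F → rowᵢ 3F refl ; 4F → rowᵢ 4F refl ; 5F → rowᵢ 5F refl }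
    where rowᵢ = row gramᵖ (indicatorᵖ inCell) (λ c → κᵖ :* indicatorᵖ inLayer c)

-- Bush-type Hadamard matrices as blocks of G

module Construction (n m : ℕ)
  (S : AssociationScheme 5 (4 ℕ.* n ℕ.^ 2 ℕ.* (m ℕ.+ 1)))
  (E : Fin 6 → SqMatrix (4 ℕ.* n ℕ.^ 2 ℕ.* (m ℕ.+ 1)))
  (E-basis : AssociationScheme.IsPrimitiveIdempotentBasis S E)
  (P-eigen : AssociationScheme.IsFirstEigenmatrix S E (P n m)) where

  open AssociationScheme S using (order-nonZero)
  open BoseMesner S
  open Eigenvalues n m

  private
    V K : ℕ
    V = 4 ℕ.* n ℕ.^ 2 ℕ.* (m ℕ.+ 1)
    K = 2 ℕ.* n

  K≡κ : fromℕ K ≡ κ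
  K≡κ = fromℕ-homo-* 2 n

  V≡κ²[m+1] : fromℕ V ≡ κ * κ * (fromℕ m + 1ℚ)
  V≡κ²[m+1] = begin
    fromℕ (4 ℕ.* (n ℕ.* (n ℕ.* 1)) ℕ.* (m ℕ.+ 1))
      ≡⟨ fromℕ-homo-* (4 ℕ.* (n ℕ.* (n ℕ.* 1))) (m ℕ.+ 1) ⟩
    fromℕ (4 ℕ.* (n ℕ.* (n ℕ.* 1))) * fromℕ (m ℕ.+ 1)
      ≡⟨ cong₂ _*_ (trans (fromℕ-homo-* 4 (n ℕ.* (n ℕ.* 1))) (cong (fromℕ 4 *_) (trans (fromℕ-homo-* n (n ℕ.* 1))
           (cong (fromℕ n *_) (fromℕ-homo-* n 1))))) (fromℕ-homo-+ m 1) ⟩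
    fromℕ 4 * (fromℕ n * (fromℕ n * 1ℚ)) * (fromℕ m + 1ℚ)
      ≡⟨ solve 2 (λ n m → con (fromℕ 4) :* (n :* (n :* con 1ℚ)) :* (m :+ con 1ℚ) :=
           (con (fromℕ 2) :* n) :* (con (fromℕ 2) :* n) :* (m :+ con 1ℚ)) refl (fromℕ n) (fromℕ m) ⟩
    κ * κ * (fromℕ m + 1ℚ) ∎

  -- A scheme has at least one vertex, and κ divides the number of vertices.
  κ≢0 : κ ≢ 0ℚ
  κ≢0 κ≡0 = ℕ.≢-nonZero⁻¹ V {{order-nonZero}} (fromℕ-injective (begin
    fromℕ V                    ≡⟨ V≡κ²[m+1] ⟩
    κ * κ * (fromℕ m + 1ℚ)     ≡⟨ *-assoc κ κ (fromℕ m + 1ℚ) ⟩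
    κ * (κ * (fromℕ m + 1ℚ))   ≡⟨ cong (_* Λ) κ≡0 ⟩
    0ℚ * Λ                     ≡⟨ *-zeroˡ Λ ⟩
    0ℚ                         ∎))

  -- Groups, layers and the entries of G

  group layer : Fin V → Fin V → Bool
  group x y = inGroup (class x y)
  layer x y = inLayer (class x y)

  G : SqMatrix V
  G = ⟪ gramCoefficient κ ⟫

  G-sym : ∀ x y → G x y ≡ G y x
  G-sym x y = cong (gramCoefficient κ) (class-sym x y)

  G-within-group : ∀ x y → group x y ≡ true → G x y ≡ κ * I V x y
  G-within-group x y xy = begin
    gramCoefficient κ (class x y)    ≡⟨ coefficient (class x y) xy ⟩
    κ * I 6 (class x y) zero         ≡⟨ cong (κ *_) (I-class x y) ⟩
    κ * I V x y                      ∎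
    where
    coefficient : ∀ c → inGroup c ≡ true → gramCoefficient κ c ≡ κ * I 6 c zero
    coefficient 0F _ = sym (*-identityʳ κ)
    coefficient 1F _ = sym (*-zeroʳ κ)
    coefficient 2F _ = sym (*-zeroʳ κ)
    coefficient 3F ()
    coefficient 4F ()
    coefficient 5F ()

  G-across-groups : ∀ x y → group x y ≡ false → G x y ≡ 1ℚ ⊎ G x y ≡ - 1ℚ
  G-across-groups x y = coefficient (class x y)
    where
    coefficient : ∀ c → inGroup c ≡ false → gramCoefficient κ c ≡ 1ℚ ⊎ gramCoefficient κ c ≡ - 1ℚ
    coefficient 0F ()
    coefficient 1F ()
    coefficient 2F ()
    coefficient 3F _ = inj₁ refl
    coefficient 4F _ = inj₁ refl
    coefficient 5F _ = inj₂ refl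

  G-within-layer : ∀ x y → group x y ≡ false → layer x y ≡ true → G x y ≡ 1ℚ
  G-within-layer x y = coefficient (class x y)
    where
    coefficient : ∀ c → inGroup c ≡ false → inLayer c ≡ true → gramCoefficient κ c ≡ 1ℚ
    coefficient 0F () _
    coefficient 1F () _
    coefficient 2F () _
    coefficient 3F _ _ = refl
    coefficient 4F _ ()
    coefficient 5F _ ()

  group-refl : ∀ x → group x x ≡ true
  group-refl x = cong inGroup (class-refl x)

  layer-refl : ∀ x → layer x x ≡ true
  layer-refl x = cong inLayer (class-refl x)

  group-sym : ∀ x y → group x y ≡ group y x
  group-sym x y = cong inGroup (class-sym x y)

  layer-sym : ∀ x y → layer x y ≡ layer y x
  layer-sym x y = cong inLayer (class-sym x y)

  private
    module Group = Uniform group (κ * κ) group-refl group-sym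
      (⟪⟫-⊛ E-basis (P n m) P-eigen (𝟙 ∘ inGroup) (𝟙 ∘ inGroup) (λ c → κ * κ * 𝟙 (inGroup c)) group-group)
    module Layer = Uniform layer Λ layer-refl layer-sym
      (⟪⟫-⊛ E-basis (P n m) P-eigen (𝟙 ∘ inLayer) (𝟙 ∘ inLayer) (λ c → Λ * 𝟙 (inLayer c)) layer-layer)

  G² : G ⊛ G ≋ Λ ⊡ G
  G² = ⟪⟫-⊛ E-basis (P n m) P-eigen (gramCoefficient κ) (gramCoefficient κ) (λ c → Λ * gramCoefficient κ c) gram-gram

  -- The sum counts the vertices common to the group of `x` and the layer of `y`, so this is the
  -- size of a cell.
  group-layer-product : ∀ x y → sum (λ z → 𝟙 (group x z) * 𝟙 (layer z y)) ≡ κ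
  group-layer-product = ⟪⟫-⊛ E-basis (P n m) P-eigen (𝟙 ∘ inGroup) (𝟙 ∘ inLayer) (λ _ → κ) group-layer

  -- The sum of row `x` of G over the cell of `y`: it vanishes unless `x` and `y` share a layer.
  G-cell-product : ∀ x y → sum (λ z → G x z * 𝟙 (group z y ∧ layer z y)) ≡ κ * 𝟙 (layer x y)
  G-cell-product = ⟪⟫-⊛ E-basis (P n m) P-eigen (gramCoefficient κ) (𝟙 ∘ inCell) (λ c → κ * 𝟙 (inLayer c)) gram-cell

  G-diagonal : ∀ x → G x x ≡ κ
  G-diagonal x = cong (gramCoefficient κ) (class-refl x)

  -- With h the group of `r`, this is the key identity entry by entry. For the kernel argument it
  -- suffices that (wG)ᵧwᵧ = 0 for each y separately; the cases are y in h, y = `x`, and all other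
  -- y.
  group-product : ∀ {r x} → group r x ≡ false → ∀ y → sum (λ z → 𝟙 (group r z) * (G x z * G z y)) ≡ κ * G x y
  group-product {r} {x} rx y = a-b≡0⇒a≡b _ _ (trans (sym (wG y))
    (isotropic⇒kernel G Λ (λ a b → G-sym b a) G² w isotropic zero y))
    where
    w : Matrix 1 V
    w _ z = 𝟙 (group r z) * G x z - κ * I V x z

    S′ : Fin V → ℚ
    S′ y = sum (λ z → 𝟙 (group r z) * (G x z * G z y))

    wG : ∀ y → (w ⊛ G) zero y ≡ S′ y - κ * G x y
    wG y = begin
      sum (λ z → (𝟙 (group r z) * G x z - κ * I V x z) * G z y)
        ≡⟨ sum-cong-≗ (λ z → solve 5 (λ d g k δ h → (d :* g :- k :* δ) :* h := d :* (g :* h) :- k :* (δ :* h)) refl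
             (𝟙 (group r z)) (G x z) κ (I V x z) (G z y)) ⟩
      sum (λ z → 𝟙 (group r z) * (G x z * G z y) - κ * (I V x z * G z y))
        ≡⟨ sum-- (λ z → 𝟙 (group r z) * (G x z * G z y)) (λ z → κ * (I V x z * G z y)) ⟩
      S′ y - sum (λ z → κ * (I V x z * G z y))
        ≡⟨ cong (λ a → S′ y - a) (*-distribˡ-sum κ (λ z → I V x z * G z y)) ⟨
      S′ y - κ * sum (λ z → I V x z * G z y)
        ≡⟨ cong (λ a → S′ y - κ * a) (sum-Iˡ x (λ z → G z y)) ⟩
      S′ y - κ * G x y ∎

    -- Since G is 2nI on h, only the term z = y survives.
    inside : ∀ {y} → group r y ≡ true → S′ y ≡ κ * G x y
    inside {y} ry = begin
      sum (λ z → 𝟙 (group r z) * (G x z * G z y))   ≡⟨ sum-cong-≗ term ⟩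
      sum (λ z → I V y z * (κ * G x z))             ≡⟨ sum-Iˡ y (λ z → κ * G x z) ⟩
      κ * G x y                                     ∎
      where
      term : ∀ z → 𝟙 (group r z) * (G x z * G z y) ≡ I V y z * (κ * G x z)
      term z with group r z in rz
      ... | true  = begin
        1ℚ * (G x z * G z y)         ≡⟨ cong (λ a → 1ℚ * (G x z * a)) (trans (G-sym z y) (G-within-group y z (trans (sym (Group.rel-cong ry z)) rz))) ⟩
        1ℚ * (G x z * (κ * I V y z)) ≡⟨ solve 3 (λ g k δ → con 1ℚ :* (g :* (k :* δ)) := δ :* (k :* g)) refl (G x z) κ (I V y z) ⟩
        I V y z * (κ * G x z)        ∎
      ... | false = begin
        0ℚ * (G x z * G z y)         ≡⟨ *-zeroˡ (G x z * G z y) ⟩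
        0ℚ                           ≡⟨ *-zeroˡ (κ * G x z) ⟨
        0ℚ * (κ * G x z)             ≡⟨ cong (_* (κ * G x z)) (I-≢ {x = y} {z} λ { refl → contradiction (trans (sym ry) rz) λ () }) ⟨
        I V y z * (κ * G x z)        ∎

    -- Each term on h is the square of ±1, so the sum is the group size 4n² = 2n · 2n.
    at-x : S′ x ≡ κ * G x x
    at-x = begin
      sum (λ z → 𝟙 (group r z) * (G x z * G z x))   ≡⟨ sum-cong-≗ term ⟩
      sum (λ z → 𝟙 (group r z))                     ≡⟨ Group.classSize r ⟩
      κ * κ                                         ≡⟨ cong (κ *_) (G-diagonal x) ⟨
      κ * G x x                                     ∎
      where
      term : ∀ z → 𝟙 (group r z) * (G x z * G z x) ≡ 𝟙 (group r z)
      term z with group r z in rz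
      ... | false = *-zeroˡ (G x z * G z x)
      ... | true  = trans (*-identityˡ (G x z * G z x)) (trans (cong (_* G z x) (G-sym x z))
                      (unit (G-across-groups z x (trans (sym (Group.rel-cong rz x)) rx))))
        where
        unit : ∀ {a} → a ≡ 1ℚ ⊎ a ≡ - 1ℚ → a * a ≡ 1ℚ
        unit (inj₁ refl) = refl
        unit (inj₂ refl) = refl

    vanishes : ∀ {y} → S′ y ≡ κ * G x y → (w ⊛ G) zero y * w zero y ≡ 0ℚ
    vanishes {y} S′y = begin
      (w ⊛ G) zero y * w zero y        ≡⟨ cong (_* w zero y) (wG y) ⟩
      (S′ y - κ * G x y) * w zero y    ≡⟨ cong (λ a → (a - κ * G x y) * w zero y) S′y ⟩
      (κ * G x y - κ * G x y) * w zero y ≡⟨ solve 2 (λ a b → (a :- a) :* b := con 0ℚ) refl (κ * G x y) (w zero y) ⟩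
      0ℚ                               ∎

    -- The support of `w` lies in h together with `x`.
    outside : ∀ {y} → group r y ≡ false → x ≢ y → w zero y ≡ 0ℚ
    outside {y} ry x≢y = begin
      𝟙 (group r y) * G x y - κ * I V x y   ≡⟨ cong₂ (λ b δ → 𝟙 b * G x y - κ * δ) ry (I-≢ {x = x} {y} x≢y) ⟩
      0ℚ * G x y - κ * 0ℚ                   ≡⟨ solve 2 (λ g k → con 0ℚ :* g :- k :* con 0ℚ := con 0ℚ) refl (G x y) κ ⟩
      0ℚ                                    ∎

    isotropic : ∀ y → (w ⊛ G) zero y * w zero y ≡ 0ℚ
    isotropic y = cases (group r y) refl (x ≟ y)
      where
      cases : ∀ b → group r y ≡ b → Dec (x ≡ y) → (w ⊛ G) zero y * w zero y ≡ 0ℚ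
      cases true  ry _          = vanishes (inside ry)
      cases false ry (yes refl) = vanishes at-x
      cases false ry (no x≢y)   = trans (cong ((w ⊛ G) zero y *_) (outside ry x≢y)) (*-zeroʳ ((w ⊛ G) zero y))

  -- Coordinates on the vertices: group, layer and position in the cell

  abstract
    groups : Transversal group (suc m)
    groups = Group.transversal (suc m) κ²≢0 (begin
      fromℕ (suc m) * (κ * κ)      ≡⟨ cong (_* (κ * κ)) (fromℕ-homo-+ 1 m) ⟩
      (1ℚ + fromℕ m) * (κ * κ)     ≡⟨ solve 2 (λ k m → (con 1ℚ :+ m) :* (k :* k) := k :* k :* (m :+ con 1ℚ)) refl κ (fromℕ m) ⟩
      κ * κ * (fromℕ m + 1ℚ)       ≡⟨ V≡κ²[m+1] ⟨
      fromℕ V                      ∎)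
      where
      κ²≢0 : κ * κ ≢ 0ℚ
      κ²≢0 κ²≡0 = κ≢0 (square-zero κ κ²≡0)

  abstract
    layers : Transversal layer K
    layers = Layer.transversal K Λ≢0 (begin
      fromℕ K * Λ                  ≡⟨ cong (_* Λ) K≡κ ⟩
      κ * (κ * (fromℕ m + 1ℚ))     ≡⟨ *-assoc κ κ (fromℕ m + 1ℚ) ⟨
      κ * κ * (fromℕ m + 1ℚ)       ≡⟨ V≡κ²[m+1] ⟨
      fromℕ V                      ∎)
      where
      Λ≢0 : Λ ≢ 0ℚ
      Λ≢0 Λ≡0 = contradiction (fromℕ-injective {suc m} {0} (trans (fromℕ-homo-+ 1 m) (trans (+-comm 1ℚ (fromℕ m))
        (*-cancelˡ-zero κ (fromℕ m + 1ℚ) κ≢0 Λ≡0)))) λ ()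

  private
    module Groups = Transversal groups
    module Layers = Transversal layers

  cell : Fin (suc m) → Fin K → Fin V → Bool
  cell g b v = group (Groups.rep g) v ∧ layer (Layers.rep b) v

  abstract
    cell-enumeration : ∀ g b → Enumeration (cell g b) K
    cell-enumeration g b = enumerateExactly (cell g b) K (begin
      sum (λ v → 𝟙 (cell g b v))
        ≡⟨ sum-cong-≗ (λ v → trans (𝟙-∧ (group (Groups.rep g) v) (layer (Layers.rep b) v))
             (cong (λ c → 𝟙 (group (Groups.rep g) v) * 𝟙 (inLayer c)) (class-sym (Layers.rep b) v))) ⟩
      sum (λ v → 𝟙 (group (Groups.rep g) v) * 𝟙 (layer v (Layers.rep b)))
        ≡⟨ group-layer-product (Groups.rep g) (Layers.rep b) ⟩
      κ
        ≡⟨ K≡κ ⟨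
      fromℕ K ∎)

  vertex : Fin (suc m) → Fin K → Fin K → Fin V
  vertex g b = Enumeration.elem (cell-enumeration g b)

  group-vertex : ∀ g b x v → group (vertex g b x) v ≡ group (Groups.rep g) v
  group-vertex g b x v = sym (Group.rel-cong (proj₁ (∧-true (Enumeration.elem-∈ (cell-enumeration g b) x))) v)

  layer-vertex : ∀ g b x v → layer (vertex g b x) v ≡ layer (Layers.rep b) v
  layer-vertex g b x v = sym (Layer.rel-cong (proj₂ (∧-true (Enumeration.elem-∈ (cell-enumeration g b) x))) v)

  group-vertices : ∀ g b x g′ b′ x′ → group (vertex g b x) (vertex g′ b′ x′) ≡ group (Groups.rep g) (Groups.rep g′)
  group-vertices g b x g′ b′ x′ = begin
    group (vertex g b x) (vertex g′ b′ x′)      ≡⟨ group-vertex g b x (vertex g′ b′ x′) ⟩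
    group (Groups.rep g) (vertex g′ b′ x′)      ≡⟨ group-sym (Groups.rep g) (vertex g′ b′ x′) ⟩
    group (vertex g′ b′ x′) (Groups.rep g)      ≡⟨ group-vertex g′ b′ x′ (Groups.rep g) ⟩
    group (Groups.rep g′) (Groups.rep g)        ≡⟨ group-sym (Groups.rep g′) (Groups.rep g) ⟩
    group (Groups.rep g) (Groups.rep g′)        ∎

  layer-vertices : ∀ g b x g′ b′ x′ → layer (vertex g b x) (vertex g′ b′ x′) ≡ layer (Layers.rep b) (Layers.rep b′)
  layer-vertices g b x g′ b′ x′ = begin
    layer (vertex g b x) (vertex g′ b′ x′)      ≡⟨ layer-vertex g b x (vertex g′ b′ x′) ⟩
    layer (Layers.rep b) (vertex g′ b′ x′)      ≡⟨ layer-sym (Layers.rep b) (vertex g′ b′ x′) ⟩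
    layer (vertex g′ b′ x′) (Layers.rep b)      ≡⟨ layer-vertex g′ b′ x′ (Layers.rep b) ⟩
    layer (Layers.rep b′) (Layers.rep b)        ≡⟨ layer-sym (Layers.rep b′) (Layers.rep b) ⟩
    layer (Layers.rep b) (Layers.rep b′)        ∎

  same-group : ∀ g b x b′ x′ → group (vertex g b x) (vertex g b′ x′) ≡ true
  same-group g b x b′ x′ = trans (group-vertices g b x g b′ x′) (group-refl (Groups.rep g))

  different-group : ∀ {g g′} → g ≢ g′ → ∀ b x b′ x′ → group (vertex g b x) (vertex g′ b′ x′) ≡ false
  different-group {g} {g′} g≢g′ b x b′ x′ =
    trans (group-vertices g b x g′ b′ x′) (Groups.separated group-refl g≢g′)

  same-layer : ∀ g x g′ b x′ → layer (vertex g b x) (vertex g′ b x′) ≡ true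
  same-layer g x g′ b x′ = trans (layer-vertices g b x g′ b x′) (layer-refl (Layers.rep b))

  different-layer : ∀ {b b′} → b ≢ b′ → ∀ g x g′ x′ → layer (vertex g b x) (vertex g′ b′ x′) ≡ false
  different-layer {b} {b′} b≢b′ g x g′ x′ =
    trans (layer-vertices g b x g′ b′ x′) (Layers.separated layer-refl b≢b′)

  -- Cells in different layers are disjoint, and within one cell the enumeration is injective.
  vertex-injective : ∀ g b x b′ x′ → vertex g b x ≡ vertex g b′ x′ → (b , x) ≡ (b′ , x′)
  vertex-injective g b x b′ x′ eq = cases (b ≟ b′)
    where
    cases : Dec (b ≡ b′) → (b , x) ≡ (b′ , x′)
    cases (yes refl) = cong (b ,_) (Enumeration.elem-injective (cell-enumeration g b) eq)
    cases (no  b≢b′) = contradiction (begin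
      true                                     ≡⟨ layer-refl (vertex g b x) ⟨
      layer (vertex g b x) (vertex g b x)      ≡⟨ cong (layer (vertex g b x)) eq ⟩
      layer (vertex g b x) (vertex g b′ x′)    ≡⟨ different-layer b≢b′ g x g x′ ⟩
      false                                    ∎) λ ()

  -- `row` is the layer and `column` the position in the cell. This is the layout of `combine`, so
  -- the Bush blocks correspond to pairs of layers.
  row column : Fin (K ℕ.* K) → Fin K
  row z    = proj₁ (remQuot {K} K z)
  column z = proj₂ (remQuot {K} K z)

  index : Fin (suc m) → Fin (K ℕ.* K) → Fin V
  index g z = vertex g (row z) (column z)

  index-combine : ∀ g b x → index g (combine b x) ≡ vertex g b x
  index-combine g b x = cong (λ p → vertex g (proj₁ p) (proj₂ p)) (remQuot-combine {K} {K} b x)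

  index-injective : ∀ g {x y} → index g x ≡ index g y → x ≡ y
  index-injective g {x} {y} eq = begin
    x                                     ≡⟨ combine-remQuot {K} K x ⟨
    uncurry (combine {K} {K}) (remQuot {K} K x)     ≡⟨ cong (uncurry (combine {K} {K})) (vertex-injective g (row x) (column x) (row y) (column y) eq) ⟩
    uncurry (combine {K} {K}) (remQuot {K} K y)     ≡⟨ combine-remQuot {K} K y ⟩
    y                                     ∎

  -- The layers cut a group into cells and every vertex lies in exactly one layer, so the cell sums
  -- add up to the sum over the group.
  sum-index : ∀ g f → sum (f ∘ index g) ≡ sum (λ v → 𝟙 (group (Groups.rep g) v) * f v)
  sum-index g f = begin
    sum (f ∘ index g)
      ≡⟨ sum-combine K {K} (f ∘ index g) ⟩
    sum {K} (λ b → sum {K} (λ x → f (index g (combine b x))))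
      ≡⟨ sum-cong-≗ (λ b → sum-cong-≗ (λ x → cong f (index-combine g b x))) ⟩
    sum (λ b → sum (λ x → f (vertex g b x)))
      ≡⟨ sum-cong-≗ (λ b → Enumeration.sum-elem (cell-enumeration g b) f) ⟩
    sum (λ b → sum (λ v → 𝟙 (cell g b v) * f v))
      ≡⟨ ∑-comm (λ b v → 𝟙 (cell g b v) * f v) ⟩
    sum (λ v → sum (λ b → 𝟙 (cell g b v) * f v))
      ≡⟨ sum-cong-≗ collect ⟩
    sum (λ v → 𝟙 (group (Groups.rep g) v) * f v) ∎
    where
    collect : ∀ v → sum (λ b → 𝟙 (cell g b v) * f v) ≡ 𝟙 (group (Groups.rep g) v) * f v
    collect v = begin
      sum (λ b → 𝟙 (cell g b v) * f v)          ≡⟨ sum-cong-≗ (λ b → trans (cong (_* f v) (𝟙-∧ (group (Groups.rep g) v) (layer (Layers.rep b) v)))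
                                                     (solve 3 (λ d l f → d :* l :* f := d :* f :* l) refl d (𝟙 (layer (Layers.rep b) v)) (f v))) ⟩
      sum (λ b → d * f v * 𝟙 (layer (Layers.rep b) v))  ≡⟨ *-distribˡ-sum (d * f v) (λ b → 𝟙 (layer (Layers.rep b) v)) ⟨
      d * f v * sum (λ b → 𝟙 (layer (Layers.rep b) v))  ≡⟨ cong (d * f v *_) (Layers.covered v) ⟩
      d * f v * 1ℚ                                      ≡⟨ *-identityʳ (d * f v) ⟩
      d * f v                                           ∎
      where d = 𝟙 (group (Groups.rep g) v)

  -- The blocks of G and their Bush-type structure

  gramBlock : Fin (suc m) → Fin (suc m) → SqMatrix (K ℕ.* K)
  gramBlock g h x y = G (index g x) (index h y)

  -- By symmetry of G the product is a sum over group `h`, and row `x` lies outside `h`, as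
  -- `group-product` demands. The case `g′` = `g` yields orthogonality of rows, other `g′` yield
  -- unbiasedness.
  gramBlock-product : ∀ {g h} → g ≢ h → ∀ g′ → gramBlock g h ⊛ gramBlock g′ h ᵗ ≋ κ ⊡ gramBlock g g′
  gramBlock-product {g} {h} g≢h g′ x y = begin
    sum (λ z → G (index g x) (index h z) * G (index g′ y) (index h z))
      ≡⟨ sum-index h (λ v → G (index g x) v * G (index g′ y) v) ⟩
    sum (λ v → 𝟙 (group (Groups.rep h) v) * (G (index g x) v * G (index g′ y) v))
      ≡⟨ sum-cong-≗ (λ v → cong (λ a → 𝟙 (group (Groups.rep h) v) * (G (index g x) v * a)) (G-sym (index g′ y) v)) ⟩
    sum (λ v → 𝟙 (group (Groups.rep h) v) * (G (index g x) v * G v (index g′ y)))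
      ≡⟨ group-product outside (index g′ y) ⟩
    κ * G (index g x) (index g′ y) ∎
    where
    outside : group (Groups.rep h) (index g x) ≡ false
    outside = begin
      group (Groups.rep h) (index g x)       ≡⟨ group-sym (Groups.rep h) (index g x) ⟩
      group (index g x) (Groups.rep h)       ≡⟨ group-vertex g (row x) (column x) (Groups.rep h) ⟩
      group (Groups.rep g) (Groups.rep h)    ≡⟨ Groups.separated group-refl g≢h ⟩
      false                                  ∎

  gramBlock-entries : ∀ {g h} → g ≢ h → ∀ x y → gramBlock g h x y ≡ 1ℚ ⊎ gramBlock g h x y ≡ - 1ℚ
  gramBlock-entries {g} {h} g≢h x y = G-across-groups (index g x) (index h y) (different-group g≢h (row x) (column x) (row y) (column y))

  gramBlock-isHadamard : ∀ {g h} → g ≢ h → IsHadamard (gramBlock g h)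
  gramBlock-isHadamard {g} {h} g≢h = record
    { entries    = gramBlock-entries g≢h
    ; orthogonal = λ x y x≢y → begin
        (gramBlock g h ⊛ gramBlock g h ᵗ) x y    ≡⟨ gramBlock-product g≢h g x y ⟩
        κ * G (index g x) (index g y)            ≡⟨ cong (κ *_) (G-within-group (index g x) (index g y) (same-group g (row x) (column x) (row y) (column y))) ⟩
        κ * (κ * I V (index g x) (index g y))    ≡⟨ cong (λ δ → κ * (κ * δ)) (I-≢ {x = index g x} {index g y} (x≢y ∘ index-injective g)) ⟩
        κ * (κ * 0ℚ)                             ≡⟨ solve 1 (λ k → k :* (k :* con 0ℚ) := con 0ℚ) refl κ ⟩
        0ℚ                                       ∎
    }

  gramBlock-combine : ∀ g h b x b′ x′ → gramBlock g h (combine b x) (combine b′ x′) ≡ G (vertex g b x) (vertex h b′ x′)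
  gramBlock-combine g h b x b′ x′ = cong₂ G (index-combine g b x) (index-combine h b′ x′)

  -- An entry of G(A₀ + A₁) = 2nD at two vertices in different layers. The argument `y` supplies a
  -- vertex of the cell being summed over.
  cell-sum : ∀ {b b′} → b ≢ b′ → ∀ g x h (y : Fin K) → sum (λ y → G (vertex g b x) (vertex h b′ y)) ≡ 0ℚ
  cell-sum {b} {b′} b≢b′ g x h y = begin
    sum (λ y → G u (vertex h b′ y))
      ≡⟨ Enumeration.sum-elem (cell-enumeration h b′) (G u) ⟩
    sum (λ v → 𝟙 (cell h b′ v) * G u v)
      ≡⟨ sum-cong-≗ (λ v → trans (*-comm (𝟙 (cell h b′ v)) (G u v)) (cong (λ c → G u v * 𝟙 c) (cell≡ v))) ⟩
    sum (λ v → G u v * 𝟙 (group v (vertex h b′ y) ∧ layer v (vertex h b′ y)))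
      ≡⟨ G-cell-product u (vertex h b′ y) ⟩
    κ * 𝟙 (layer u (vertex h b′ y))
      ≡⟨ cong (λ c → κ * 𝟙 c) (different-layer b≢b′ g x h y) ⟩
    κ * 0ℚ
      ≡⟨ *-zeroʳ κ ⟩
    0ℚ ∎
    where
    u = vertex g b x

    cell≡ : ∀ v → cell h b′ v ≡ group v (vertex h b′ y) ∧ layer v (vertex h b′ y)
    cell≡ v = cong₂ _∧_ (trans (sym (group-vertex h b′ y v)) (group-sym (vertex h b′ y) v))
                        (trans (sym (layer-vertex h b′ y v)) (layer-sym (vertex h b′ y) v))

  gramBlock-isBushType : ∀ {g h} → g ≢ h → IsBushType n (gramBlock g h)
  gramBlock-isBushType {g} {h} g≢h = record
    { isHadamard    = gramBlock-isHadamard g≢h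
    ; diagonal      = λ b x y → trans (gramBlock-combine g h b x b y)
                        (G-within-layer (vertex g b x) (vertex h b y) (different-group g≢h b x b y) (same-layer g x h b y))
    ; off-diagonalʳ = λ b b′ b≢b′ x y → trans
        (sum-cong-≗ (λ z → trans (*-identityʳ _) (gramBlock-combine g h b x b′ z)))
        (cell-sum b≢b′ g x h y)
    -- A column sum of the block from `g` to `h` is, by symmetry of G, a row sum of the block from
    -- `h` to `g`.
    ; off-diagonalˡ = λ b b′ b≢b′ x y → trans
        (sum-cong-≗ (λ z → trans (*-identityˡ _) (trans (gramBlock-combine g h b z b′ y) (G-sym (vertex g b z) (vertex h b′ y)))))
        (cell-sum (b≢b′ ∘ sym) h y g x)
    }

  -- The m matrices taken against group 0

  H : Fin m → SqMatrix (K ℕ.* K)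
  H i = gramBlock (suc i) zero

  H-unbiased : ∀ {i j} → i ≢ j → Unbiased (H i) (H j)
  -- The square root of 4n² is 2n, and the Hadamard matrix L is the block of G between the two
  -- groups.
  H-unbiased {i} {j} i≢j = κ , subst (0ℚ ≤_) K≡κ (fromℕ-nonneg K) ,
    sym (trans (fromℕ-homo-* K K) (cong₂ _*_ K≡κ K≡κ)) ,
    gramBlock (suc i) (suc j) , gramBlock-isHadamard (i≢j ∘ suc-injective) , gramBlock-product (λ ()) (suc j)

  -- 2n is even, which excludes 1, and nonnegative, which excludes -1.
  κ≢±1 : ∀ {a} → a ≡ 1ℚ ⊎ a ≡ - 1ℚ → κ ≢ a
  κ≢±1 (inj₁ refl) κ≡1 = ℕ.even≢odd n 0 (fromℕ-injective (trans K≡κ κ≡1))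
  κ≢±1 (inj₂ refl) κ≡-1 = contradiction (cong ℚ.numerator (trans K≡κ κ≡-1)) λ ()

  -- Equal H i and H j would make a diagonal entry of (H i)(H j)ᵗ both κ² and ±κ.
  H-distinct : Fin (K ℕ.* K) → Distinct H
  H-distinct x i j Hi≋Hj = decidable-stable (i ≟ j) λ i≢j →
    κ≢±1 (gramBlock-entries (i≢j ∘ suc-injective) x x) (a-b≡0⇒a≡b κ a (*-cancelˡ-zero κ (κ - a) κ≢0 (begin
      κ * (κ - a)        ≡⟨ solve 2 (λ k a → k :* (k :- a) := k :* k :- k :* a) refl κ a ⟩
      κ * κ - κ * a      ≡⟨ cong (_- κ * a) κκ≡κa ⟩
      κ * a - κ * a      ≡⟨ +-inverseʳ (κ * a) ⟩
      0ℚ                 ∎)))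
    where
    a : ℚ
    a = gramBlock (suc i) (suc j) x x

    κκ≡κa : κ * κ ≡ κ * a
    κκ≡κa = begin
      κ * κ                                ≡⟨ cong (κ *_) (G-diagonal (index (suc i) x)) ⟨
      κ * gramBlock (suc i) (suc i) x x    ≡⟨ gramBlock-product {suc i} {zero} (λ ()) (suc i) x x ⟨
      (H i ⊛ H i ᵗ) x x                    ≡⟨ sum-cong-≗ (λ z → cong (H i x z *_) (Hi≋Hj x z)) ⟩
      (H i ⊛ H j ᵗ) x x                    ≡⟨ gramBlock-product {suc i} {zero} (λ ()) (suc j) x x ⟩
      κ * a                                ∎

theorem3p6 : (n m : ℕ) → 1 ℕ.≤ n → 2 ℕ.≤ m →
    (S : AssociationScheme 5 (4 ℕ.* n ℕ.^ 2 ℕ.* (m ℕ.+ 1))) →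
    (let open AssociationScheme S) →
    (E : Fin 6 → SqMatrix (4 ℕ.* n ℕ.^ 2 ℕ.* (m ℕ.+ 1))) →
    IsPrimitiveIdempotentBasis E →
    IsFirstEigenmatrix E (P n m) →
    IsSecondEigenmatrix E (Q n m) →
    Σ[ H ∈ (Fin m → SqMatrix ((2 ℕ.* n) ℕ.* (2 ℕ.* n))) ]
    (Distinct H × (∀ i → IsBushType n (H i)) × MutuallyUnbiased H)
theorem3p6 n m 1≤n _ S E E-basis P-eigen _ =
  -- As n ≥ 1, the index 0 exists; it supplies the diagonal entry by which equal matrices are
  -- excluded.
  H , H-distinct (fromℕ< (ℕ.*-mono-≤ 1≤K 1≤K)) , (λ i → gramBlock-isBushType λ ()) ,
  λ i j Hi≢Hj → H-unbiased λ { refl → Hi≢Hj λ _ _ → refl }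
  where
  open Construction n m S E E-basis P-eigen
  1≤K : 1 ℕ.≤ 2 ℕ.* n
  1≤K = ℕ.≤-trans 1≤n (ℕ.m≤m+n n (n ℕ.+ 0))
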